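{- Let $\lambda\in\mathbb{C}$, $\lambda\neq 0$, and let $[\alpha,\beta]$ be a real interval. 1. Let $f:[\alpha,\beta]\to\mathbb{C}$ be a function such that $f\in\mathcal{L}_\lambda^1[\alpha,x]$ for all $x\in[\alpha,\beta]$. Then, for $x\neq 0$, $$\mathbf{D}_\lambda\int_\alpha^x f(t)\,d_\lambda t=f(x)-\frac{\alpha}{\lambda}f\left(\frac{\alpha}{\lambda}\right)\frac{1}{x}.$$ 2. Let $f:[\alpha,\beta]\to\mathbb{C}$ be a function such that $\mathbf{D}_\lambda f\in\mathcal{L}_\lambda^1[\alpha,\beta]$. Then $$\int_\alpha^\beta \mathbf{D}_\lambda f(x)\,d_\lambda x=f(\beta)-f(\alpha).$$
   Context: The $\lambda$-derivative of a function $f$ is $(\mathbf{D}_\lambda f)(x)=\frac{f(\lambda x)}{x}$ for $x\neq 0$, and $(\mathbf{D}_\lambda f)(0)=\lim_{x\to 0}\frac{f(\lambda x)}{x}$, provided that the limit exists. In part 1, $\mathbf{D}_\lambda$ acts on the function $F(y)=\int_\alpha^y f(t)\,d_\lambda t$ of its upper limit, and the result is evaluated at $y=x$. The $\lambda$-integral in $[0,x]$ is defined, for a continuous function $f:[0,x]\to\mathbb{C}$, by $\int_0^x f(t)\,d_\lambda t=\frac{x}{\lambda}f\left(\frac{x}{\lambda}\right)$ provided that $f(x/\lambda)$ exists, and $\int_\alpha^\beta f(x)\,d_\lambda x=\int_0^\beta f(x)\,d_\lambda x-\int_0^\alpha f(x)\,d_\lambda x$, so that $\int_\alpha^\beta f(x)\,d_\lambda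 x=\frac{\beta}{\lambda}f\left(\frac{\beta}{\lambda}\right)-\frac{\alpha}{\lambda}f\left(\frac{\alpha}{\lambda}\right)$. A function is called $\lambda$-integrable in $[\alpha,\beta]$ provided that it is defined at $\alpha/\lambda$ and $\beta/\lambda$. $\mathcal{L}_\lambda^1[\alpha,\beta]$ is the set of functions $f:[\alpha,\beta]\to\mathbb{C}$ such that $|f|$ is $\lambda$-integrable in $[\alpha,\beta]$, i.e. $\int_\alpha^\beta|f|\,d_\lambda x<\infty$. Convention: a function on $[\alpha,\beta]$ may also be defined at points outside $[\alpha,\beta]$; the formulas above evaluate it at such points whenever they call for it.
   Formalization: Part 2 additionally assumes, only when α=0 or β=0, that f restricted to [α,β] is continuous at 0; without this it fails, e.g. λ=1 on [0,1] with f(0)=1 and f(x)=x otherwise. -}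

module Defs where

open import Data.Integer.Base as ℤ using (+_)
import Data.Integer.Properties as ℤ
open import Data.Nat.Base as ℕ using (ℕ; zero; suc)
import Data.Nat.Properties as ℕ
open import Data.Nat.Coprimality as ℕ using (1-coprimeTo)
open import Data.Product using (Σ; ∃; ∃-syntax; _×_; _,_; proj₁; proj₂)
open import Data.Rational.Base as ℚ using (ℚ; 0ℚ; 1ℚ; ½)
import Data.Rational.Properties as ℚ
open import Data.Rational.Solver using (module +-*-Solver)
open import Data.Sum using (_⊎_; inj₁; inj₂)
open import Relation.Binary.PropositionalEquality
  using (_≡_; _≢_; refl; sym; trans; cong; cong₂; subst; subst₂)
open import Relation.Nullary using (¬_; yes; no; contradiction)

module Estimates where

  open import Data.Rational.Base using (_+_; _*_; _-_; -_; _≤_; _<_; ∣_∣; 1/_; mkℚ)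
  open +-*-Solver

  0<1 : 0ℚ < 1ℚ
  0<1 = ℚ.positive⁻¹ 1ℚ

  *-pos : ∀ {p q} → 0ℚ < p → 0ℚ < q → 0ℚ < p * q
  *-pos {p} {q} 0<p 0<q =
    ℚ.positive⁻¹ (p * q) {{ℚ.pos*pos⇒pos p {{ℚ.positive 0<p}} q {{ℚ.positive 0<q}}}}

  *-nonNeg : ∀ {p q} → 0ℚ ≤ p → 0ℚ ≤ q → 0ℚ ≤ p * q
  *-nonNeg {p} {q} 0≤p 0≤q = ℚ.nonNegative⁻¹ (p * q)
    {{ℚ.nonNeg*nonNeg⇒nonNeg p {{ℚ.nonNegative 0≤p}} q {{ℚ.nonNegative 0≤q}}}}

  +-pos : ∀ {p q} → 0ℚ < p → 0ℚ ≤ q → 0ℚ < p + q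
  +-pos {p} {q} 0<p 0≤q = subst (_< p + q) (ℚ.+-identityˡ 0ℚ) (ℚ.+-mono-<-≤ 0<p 0≤q)

  *-mono : ∀ {p q r s} → 0ℚ ≤ p → 0ℚ ≤ s → p ≤ q → r ≤ s → p * r ≤ q * s
  *-mono {p} {q} {r} {s} 0≤p 0≤s p≤q r≤s = ℚ.≤-trans
    (ℚ.*-monoˡ-≤-nonNeg p {{ℚ.nonNegative 0≤p}} r≤s)
    (ℚ.*-monoʳ-≤-nonNeg s {{ℚ.nonNegative 0≤s}} p≤q)

  half-pos : ∀ {ε} → 0ℚ < ε → 0ℚ < ½ * ε
  half-pos = *-pos (ℚ.positive⁻¹ ½)

  halves : ∀ ε → ½ * ε + ½ * ε ≡ ε
  halves = solve 1 (λ ε → con ½ :* ε :+ con ½ :* ε := ε) refl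

  0≤p² : ∀ p → 0ℚ ≤ p * p
  0≤p² p with ℚ.∣p∣≡p∨∣p∣≡-p p
  ... | inj₁ eq = subst (0ℚ ≤_) (cong₂ _*_ eq eq) (*-nonNeg (ℚ.0≤∣p∣ p) (ℚ.0≤∣p∣ p))
  ... | inj₂ eq = subst (0ℚ ≤_)
    (trans (cong₂ _*_ eq eq) (solve 1 (λ x → :- x :* :- x := x :* x) refl p))
    (*-nonNeg (ℚ.0≤∣p∣ p) (ℚ.0≤∣p∣ p))

  ∣p∣²≡p² : ∀ p → ∣ p ∣ * ∣ p ∣ ≡ p * p
  ∣p∣²≡p² p = trans (sym (ℚ.∣p*q∣≡∣p∣*∣q∣ p p)) (ℚ.0≤p⇒∣p∣≡p (0≤p² p))

  p≤∣p∣ : ∀ p → p ≤ ∣ p ∣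
  p≤∣p∣ p with ℚ.≤-total 0ℚ p
  ... | inj₁ 0≤p = ℚ.≤-reflexive (sym (ℚ.0≤p⇒∣p∣≡p 0≤p))
  ... | inj₂ p≤0 = ℚ.≤-trans p≤0 (ℚ.0≤∣p∣ p)

  -p≤∣p∣ : ∀ p → - p ≤ ∣ p ∣
  -p≤∣p∣ p = subst (- p ≤_) (ℚ.∣-p∣≡∣p∣ p) (p≤∣p∣ (- p))

  ∣p∣≤-intro : ∀ {p e} → p ≤ e → - p ≤ e → ∣ p ∣ ≤ e
  ∣p∣≤-intro {p} {e} p≤e -p≤e with ℚ.∣p∣≡p∨∣p∣≡-p p
  ... | inj₁ eq = subst (_≤ e) (sym eq) p≤e
  ... | inj₂ eq = subst (_≤ e) (sym eq) -p≤e

  swap-minus : ∀ p q → p - q ≡ - (q - p)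
  swap-minus = solve 2 (λ p q → p :- q := :- (q :- p)) refl

  square-mono : ∀ {p q} → 0ℚ ≤ p → p ≤ ∣ q ∣ → p * p ≤ q * q
  square-mono {p} {q} 0≤p p≤∣q∣ =
    subst (p * p ≤_) (∣p∣²≡p² q) (*-mono 0≤p (ℚ.0≤∣p∣ q) p≤∣q∣ p≤∣q∣)

  recip : ℚ → ℚ
  recip q with q ℚ.≟ 0ℚ
  ... | yes _   = 0ℚ
  ... | no  q≢0 = (1/ q) {{ℚ.≢-nonZero q≢0}}

  recip-inverseˡ : ∀ {q} → q ≢ 0ℚ → recip q * q ≡ 1ℚ
  recip-inverseˡ {q} q≢0 with q ℚ.≟ 0ℚ
  ... | yes q≡0 = contradiction q≡0 q≢0
  ... | no  q≢0 = ℚ.*-inverseˡ q {{ℚ.≢-nonZero q≢0}}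

  pos⇒≢0 : ∀ {q} → 0ℚ < q → q ≢ 0ℚ
  pos⇒≢0 0<q q≡0 = ℚ.<-irrefl (sym q≡0) 0<q

  recip-pos : ∀ {q} → 0ℚ < q → 0ℚ < recip q
  recip-pos {q} 0<q = ℚ.≰⇒> λ r≤0 → ℚ.<-irrefl refl (ℚ.<-≤-trans 0<1
    (subst₂ _≤_ (recip-inverseˡ (pos⇒≢0 0<q)) (ℚ.*-zeroˡ q)
      (ℚ.*-monoʳ-≤-nonNeg q {{ℚ.nonNegative (ℚ.<⇒≤ 0<q)}} r≤0)))

  cancel-recip : ∀ {D} e → 0ℚ < D → D * (e * recip D) ≡ e
  cancel-recip {D} e 0<D = trans
    (solve 3 (λ d h r → d :* (h :* r) := (r :* d) :* h) refl D e (recip D))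
    (trans (cong (_* e) (recip-inverseˡ (pos⇒≢0 0<D))) (ℚ.*-identityˡ e))

  product-close : ∀ {B C} e a b a′ b′ → 0ℚ < e → 0ℚ < B → 0ℚ < C →
                  ∣ a ∣ ≤ B → ∣ b′ ∣ ≤ C → ∣ a - a′ ∣ ≤ e * recip C → ∣ b - b′ ∣ ≤ e * recip B →
                  ∣ a * b - a′ * b′ ∣ ≤ e + e
  product-close {B} {C} e a b a′ b′ 0<e 0<B 0<C a≤ b′≤ da db = begin
    ∣ a * b - a′ * b′ ∣
      ≡⟨ cong ∣_∣ (solve 4 (λ a b a′ b′ → a :* b :- a′ :* b′
                              := a :* (b :- b′) :+ b′ :* (a :- a′)) refl a b a′ b′) ⟩
    ∣ a * (b - b′) + b′ * (a - a′) ∣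
      ≤⟨ ℚ.∣p+q∣≤∣p∣+∣q∣ (a * (b - b′)) (b′ * (a - a′)) ⟩
    ∣ a * (b - b′) ∣ + ∣ b′ * (a - a′) ∣
      ≡⟨ cong₂ _+_ (ℚ.∣p*q∣≡∣p∣*∣q∣ a (b - b′)) (ℚ.∣p*q∣≡∣p∣*∣q∣ b′ (a - a′)) ⟩
    ∣ a ∣ * ∣ b - b′ ∣ + ∣ b′ ∣ * ∣ a - a′ ∣
      ≤⟨ ℚ.+-mono-≤
           (*-mono (ℚ.0≤∣p∣ a) (ℚ.<⇒≤ (*-pos {e} {recip B} 0<e (recip-pos 0<B))) a≤ db)
           (*-mono (ℚ.0≤∣p∣ b′) (ℚ.<⇒≤ (*-pos {e} {recip C} 0<e (recip-pos 0<C))) b′≤ da) ⟩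
    B * (e * recip B) + C * (e * recip C)
      ≡⟨ cong₂ _+_ (cancel-recip e 0<B) (cancel-recip e 0<C) ⟩
    e + e ∎
    where open ℚ.≤-Reasoning

  -- The embedding of ℕ, in a form that computes on variables.
  fromℕ : ℕ → ℚ
  fromℕ n = mkℚ (+ n) 0 (ℕ.sym (1-coprimeTo n))

  fromℕ-suc : ∀ n → fromℕ n + 1ℚ ≡ fromℕ (suc n)
  fromℕ-suc n = trans
    (cong (ℚ._/ 1) (trans (cong (ℤ._+ + 1) (ℤ.*-identityʳ (+ n))) (ℤ.+-comm (+ n) (+ 1))))
    (ℚ.↥p/↧p≡p (fromℕ (suc n)))

  fromℕ-mono : ∀ {m n} → m ℕ.≤ n → fromℕ m ≤ fromℕ n
  fromℕ-mono {m} {n} m≤n =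
    ℚ.*≤* (subst₂ ℤ._≤_ (sym (ℤ.*-identityʳ (+ m))) (sym (ℤ.*-identityʳ (+ n))) (ℤ.+≤+ m≤n))

  fromℕ-pos : ∀ n → 0ℚ < fromℕ (suc n)
  fromℕ-pos n = ℚ.positive⁻¹ (fromℕ (suc n))

  archimedean : ∀ q → ∃[ n ] q ≤ fromℕ n
  archimedean q@(mkℚ (+ n) d c) = n , ℚ.*≤* (ℤ.≤-trans
    (ℤ.≤-reflexive (ℤ.*-identityʳ (+ n)))
    (subst (+ n ℤ.≤_) (ℤ.pos-* n (suc d)) (ℤ.+≤+ (ℕ.m≤m*n n (suc d)))))
  archimedean q@(mkℚ ℤ.-[1+ n ] d c) = 0 ,
    ℚ.<⇒≤ (ℚ.negative⁻¹ q)

  mesh : ℕ → ℚ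
  mesh n = recip (fromℕ (suc n))

  mesh-pos : ∀ n → 0ℚ < mesh n
  mesh-pos n = recip-pos (fromℕ-pos n)

  mesh-small : ∀ {ε} → 0ℚ < ε → ∃[ N ] ∀ n → N ℕ.≤ n → mesh n ≤ ε
  mesh-small {ε} 0<ε with archimedean (recip ε)
  ... | N , r≤N = N , λ n N≤n → subst₂ _≤_ (lhs n) (rhs n)
        (*-mono (ℚ.<⇒≤ (mesh-pos n)) (ℚ.<⇒≤ (*-pos (fromℕ-pos n) 0<ε)) ℚ.≤-refl
          (ℚ.*-monoʳ-≤-nonNeg ε {{ℚ.nonNegative (ℚ.<⇒≤ 0<ε)}}
            (ℚ.≤-trans r≤N (fromℕ-mono (ℕ.≤-trans N≤n (ℕ.n≤1+n n))))))
    where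
    lhs : ∀ n → mesh n * (recip ε * ε) ≡ mesh n
    lhs n = trans (cong (mesh n *_) (recip-inverseˡ (pos⇒≢0 0<ε))) (ℚ.*-identityʳ _)
    rhs : ∀ n → mesh n * (fromℕ (suc n) * ε) ≡ ε
    rhs n = trans (sym (ℚ.*-assoc (mesh n) (fromℕ (suc n)) ε))
      (trans (cong (_* ε) (recip-inverseˡ (pos⇒≢0 (fromℕ-pos n)))) (ℚ.*-identityˡ ε))

  IsRoot : ℚ → ℚ → ℚ → Set
  IsRoot q ε s = 0ℚ ≤ s × s * s ≤ q × q < (s + ε) * (s + ε)

  abstract
    root : ∀ {q ε} → 0ℚ ≤ q → 0ℚ < ε → Σ ℚ (IsRoot q ε)
    root {q} {ε} 0≤q 0<ε = search (suc B) overshoot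
      where
      step : ℕ → ℚ
      step k = fromℕ k * ε

      step-suc : ∀ k → step (suc k) ≡ step k + ε
      step-suc k = trans (cong (_* ε) (sym (fromℕ-suc k)))
        (solve 2 (λ x e → (x :+ con 1ℚ) :* e := x :* e :+ e) refl (fromℕ k) ε)

      step-nonNeg : ∀ k → 0ℚ ≤ step k
      step-nonNeg k = *-nonNeg (fromℕ-mono {0} {k} ℕ.z≤n) (ℚ.<⇒≤ 0<ε)

      B : ℕ
      B = proj₁ (archimedean ((q + 1ℚ) * recip ε))

      q+1≤step : q + 1ℚ ≤ step B
      q+1≤step = subst (_≤ step B)
        (trans (ℚ.*-assoc (q + 1ℚ) (recip ε) ε)
          (trans (cong ((q + 1ℚ) *_) (recip-inverseˡ (pos⇒≢0 0<ε))) (ℚ.*-identityʳ _)))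
        (ℚ.*-monoʳ-≤-nonNeg ε {{ℚ.nonNegative (ℚ.<⇒≤ 0<ε)}}
          (proj₂ (archimedean ((q + 1ℚ) * recip ε))))

      q<q+1 : q < q + 1ℚ
      q<q+1 = subst (_< q + 1ℚ) (ℚ.+-identityʳ q) (ℚ.+-monoʳ-< q 0<1)

      1≤q+1 : 1ℚ ≤ q + 1ℚ
      1≤q+1 = subst (_≤ q + 1ℚ) (ℚ.+-identityˡ 1ℚ) (ℚ.+-monoˡ-≤ 1ℚ 0≤q)

      step-mono : step B ≤ step (suc B)
      step-mono = ℚ.*-monoʳ-≤-nonNeg ε {{ℚ.nonNegative (ℚ.<⇒≤ 0<ε)}} (fromℕ-mono (ℕ.n≤1+n B))

      overshoot : q < step (suc B) * step (suc B)
      overshoot = ℚ.<-≤-trans q<q+1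
        (subst (_≤ step (suc B) * step (suc B)) (ℚ.*-identityʳ (q + 1ℚ))
          (*-mono (ℚ.≤-trans 0≤q (ℚ.<⇒≤ q<q+1)) (step-nonNeg (suc B))
            (ℚ.≤-trans q+1≤step step-mono)
            (ℚ.≤-trans 1≤q+1 (ℚ.≤-trans q+1≤step step-mono))))

      search : ∀ k → q < step k * step k → Σ ℚ (IsRoot q ε)
      search zero    q<0 = contradiction
        (subst (q <_) (trans (cong₂ _*_ (ℚ.*-zeroˡ ε) (ℚ.*-zeroˡ ε)) (ℚ.*-zeroˡ 0ℚ)) q<0)
        (λ q<0 → ℚ.<-irrefl refl (ℚ.<-≤-trans q<0 0≤q))
      search (suc k) q<s with q ℚ.<? step k * step k
      ... | yes q<t = search k q<t
      ... | no  q≮t = step k , step-nonNeg k , ℚ.≮⇒≥ q≮t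
                    , subst (q <_) (cong₂ _*_ (step-suc k) (step-suc k)) q<s

  root-close : ∀ {p q s t ε δ} h → 0ℚ < h → IsRoot p ε s → IsRoot q δ t →
               0ℚ < δ → δ ≤ h → p - q ≤ h * h → s - t ≤ h + h
  root-close {p} {q} {s} {t} {ε} {δ} h 0<h (_ , s²≤p , _) (0≤t , _ , q<[t+δ]²) 0<δ δ≤h p-q≤ =
    subst (s - t ≤_) (solve 2 (λ t e → (t :+ e) :- t := e) refl t (h + h))
      (ℚ.+-monoˡ-≤ (- t) (ℚ.≮⇒≥ λ t+2h<s → ℚ.<-irrefl refl (p<p t+2h<s)))
    where
    open ℚ.≤-Reasoning

    0≤+ : ∀ {u v} → 0ℚ ≤ u → 0ℚ ≤ v → 0ℚ ≤ u + v
    0≤+ {u} {v} 0≤u 0≤v = subst (_≤ u + v) (ℚ.+-identityˡ 0ℚ) (ℚ.+-mono-≤ 0≤u 0≤v)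

    0≤h : 0ℚ ≤ h
    0≤h = ℚ.<⇒≤ 0<h

    0≤t+2h : 0ℚ ≤ t + (h + h)
    0≤t+2h = 0≤+ 0≤t (0≤+ 0≤h 0≤h)

    excess : ℚ
    excess = (t + h) * h + (t + h) * h

    0≤excess : 0ℚ ≤ excess
    0≤excess = 0≤+ (*-nonNeg (0≤+ 0≤t 0≤h) 0≤h) (*-nonNeg (0≤+ 0≤t 0≤h) 0≤h)

    p<p : t + (h + h) < s → p < p
    p<p t+2h<s = begin-strict
      p                                        ≡⟨ solve 2 (λ p q → p := q :+ (p :- q)) refl p q ⟩
      q + (p - q)                              ≤⟨ ℚ.+-monoʳ-≤ q p-q≤ ⟩
      q + h * h                                <⟨ ℚ.+-monoˡ-< (h * h) q<[t+δ]² ⟩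
      (t + δ) * (t + δ) + h * h                ≤⟨ ℚ.+-monoˡ-≤ (h * h)
                                                    (*-mono (0≤+ 0≤t (ℚ.<⇒≤ 0<δ)) (0≤+ 0≤t 0≤h)
                                                      (ℚ.+-monoʳ-≤ t δ≤h) (ℚ.+-monoʳ-≤ t δ≤h)) ⟩
      (t + h) * (t + h) + h * h                ≡⟨ sym (ℚ.+-identityʳ _) ⟩
      ((t + h) * (t + h) + h * h) + 0ℚ         ≤⟨ ℚ.+-monoʳ-≤ ((t + h) * (t + h) + h * h) 0≤excess ⟩
      ((t + h) * (t + h) + h * h) + excess     ≡⟨ solve 2 (λ t h → ((t :+ h) :* (t :+ h) :+ h :* h)
                                                                    :+ ((t :+ h) :* h :+ (t :+ h) :* h)
                                                                 := (t :+ (h :+ h)) :* (t :+ (h :+ h))) refl t h ⟩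
      (t + (h + h)) * (t + (h + h))            ≤⟨ *-mono 0≤t+2h (ℚ.≤-trans 0≤t+2h (ℚ.<⇒≤ t+2h<s))
                                                    (ℚ.<⇒≤ t+2h<s) (ℚ.<⇒≤ t+2h<s) ⟩
      s * s                                    ≤⟨ s²≤p ⟩
      p                                        ∎

IsCauchy : (ℕ → ℚ) → Set
IsCauchy s = ∀ ε → 0ℚ ℚ.< ε → ∃[ N ] ∀ m n → N ℕ.≤ m → N ℕ.≤ n → ℚ.∣ s m ℚ.- s n ∣ ℚ.≤ ε

record ℝ : Set where
  constructor mkℝ
  field
    seq    : ℕ → ℚ
    cauchy : IsCauchy seq

open ℝ public

module Real where

  open Estimates
  open +-*-Solver

  infix  4 _≈_ _<_ _≤_ _#_
  infixl 6 _+_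
  infixl 7 _*_
  infix  8 -_

  _≈_ : ℝ → ℝ → Set
  x ≈ y = ∀ ε → 0ℚ ℚ.< ε → ∃[ N ] ∀ n → N ℕ.≤ n → ℚ.∣ seq x n ℚ.- seq y n ∣ ℚ.≤ ε

  _<_ : ℝ → ℝ → Set
  x < y = ∃[ ε ] 0ℚ ℚ.< ε × ∃[ N ] ∀ n → N ℕ.≤ n → seq x n ℚ.+ ε ℚ.≤ seq y n

  _≤_ : ℝ → ℝ → Set
  x ≤ y = ¬ (y < x)

  -- The constructive form of "x ≠ y", needed for division.
  _#_ : ℝ → ℝ → Set
  x # y = x < y ⊎ y < x

  fromℚ : ℚ → ℝ
  fromℚ q = mkℝ (λ _ → q) λ ε 0<ε → 0 , λ _ _ _ _ →
    subst (ℚ._≤ ε) (sym (cong ℚ.∣_∣ (ℚ.+-inverseʳ q))) (ℚ.<⇒≤ 0<ε)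

  0ℝ 1ℝ : ℝ
  0ℝ = fromℚ 0ℚ
  1ℝ = fromℚ 1ℚ

  _+_ : ℝ → ℝ → ℝ
  x + y = mkℝ (λ n → seq x n ℚ.+ seq y n) c
    where
    c : IsCauchy (λ n → seq x n ℚ.+ seq y n)
    c ε 0<ε with cauchy x (½ ℚ.* ε) (half-pos 0<ε) | cauchy y (½ ℚ.* ε) (half-pos 0<ε)
    ... | M , p | N , q = M ℕ.⊔ N , λ m n m≥ n≥ → ℚ.≤-trans
      (subst (ℚ._≤ ℚ.∣ seq x m ℚ.- seq x n ∣ ℚ.+ ℚ.∣ seq y m ℚ.- seq y n ∣)
        (cong ℚ.∣_∣ (solve 4 (λ a b a′ b′ → (a :- a′) :+ (b :- b′) := (a :+ b) :- (a′ :+ b′))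
          refl (seq x m) (seq y m) (seq x n) (seq y n)))
        (ℚ.∣p+q∣≤∣p∣+∣q∣ (seq x m ℚ.- seq x n) (seq y m ℚ.- seq y n)))
      (subst (ℚ.∣ seq x m ℚ.- seq x n ∣ ℚ.+ ℚ.∣ seq y m ℚ.- seq y n ∣ ℚ.≤_) (halves ε)
        (ℚ.+-mono-≤ (p m n (ℕ.m⊔n≤o⇒m≤o M N m≥) (ℕ.m⊔n≤o⇒m≤o M N n≥))
                    (q m n (ℕ.m⊔n≤o⇒n≤o M N m≥) (ℕ.m⊔n≤o⇒n≤o M N n≥))))

  -_ : ℝ → ℝ
  - x = mkℝ (λ n → ℚ.- seq x n) c
    where
    c : IsCauchy (λ n → ℚ.- seq x n)
    c ε 0<ε with cauchy x ε 0<ε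
    ... | N , p = N , λ m n m≥ n≥ → subst (ℚ._≤ ε)
      (cong ℚ.∣_∣ (solve 2 (λ a b → b :- a := :- a :- :- b) refl (seq x m) (seq x n)))
      (p n m n≥ m≥)

  bound : ∀ x → ∃[ B ] 0ℚ ℚ.< B × ∃[ N ] ∀ n → N ℕ.≤ n → ℚ.∣ seq x n ∣ ℚ.≤ B
  bound x with cauchy x 1ℚ 0<1
  ... | N , p = 1ℚ ℚ.+ ℚ.∣ seq x N ∣ , +-pos 0<1 (ℚ.0≤∣p∣ (seq x N)) , N , λ n n≥ → ℚ.≤-trans
    (subst (ℚ._≤ ℚ.∣ seq x n ℚ.- seq x N ∣ ℚ.+ ℚ.∣ seq x N ∣)
      (cong ℚ.∣_∣ (solve 2 (λ a b → (a :- b) :+ b := a) refl (seq x n) (seq x N)))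
      (ℚ.∣p+q∣≤∣p∣+∣q∣ (seq x n ℚ.- seq x N) (seq x N)))
    (ℚ.+-monoˡ-≤ ℚ.∣ seq x N ∣ (p n N n≥ ℕ.≤-refl))

  abstract
    *-cauchy : ∀ x y {B C} → 0ℚ ℚ.< B → 0ℚ ℚ.< C →
               (∃[ N ] ∀ n → N ℕ.≤ n → ℚ.∣ seq x n ∣ ℚ.≤ B) →
               (∃[ N ] ∀ n → N ℕ.≤ n → ℚ.∣ seq y n ∣ ℚ.≤ C) →
               ∀ e → 0ℚ ℚ.< e → ∃[ N ] ∀ m n → N ℕ.≤ m → N ℕ.≤ n →
                 ℚ.∣ seq x m ℚ.* seq y m ℚ.- seq x n ℚ.* seq y n ∣ ℚ.≤ e ℚ.+ e
    *-cauchy x y {B} {C} 0<B 0<C (K , ∣x∣≤B) (L , ∣y∣≤C) e 0<e =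
      combine (cauchy x (e ℚ.* recip C) (*-pos {e} {recip C} 0<e (recip-pos 0<C)))
              (cauchy y (e ℚ.* recip B) (*-pos {e} {recip B} 0<e (recip-pos 0<B)))
      where
      combine : (∃[ N ] ∀ m n → N ℕ.≤ m → N ℕ.≤ n → ℚ.∣ seq x m ℚ.- seq x n ∣ ℚ.≤ e ℚ.* recip C) →
                (∃[ N ] ∀ m n → N ℕ.≤ m → N ℕ.≤ n → ℚ.∣ seq y m ℚ.- seq y n ∣ ℚ.≤ e ℚ.* recip B) →
                ∃[ N ] ∀ m n → N ℕ.≤ m → N ℕ.≤ n →
                  ℚ.∣ seq x m ℚ.* seq y m ℚ.- seq x n ℚ.* seq y n ∣ ℚ.≤ e ℚ.+ e
      combine (M , p) (N , q) = (K ℕ.⊔ L) ℕ.⊔ (M ℕ.⊔ N) , λ m n m≥ n≥ →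
        let m≥KL = ℕ.m⊔n≤o⇒m≤o (K ℕ.⊔ L) (M ℕ.⊔ N) m≥
            n≥KL = ℕ.m⊔n≤o⇒m≤o (K ℕ.⊔ L) (M ℕ.⊔ N) n≥
            m≥MN = ℕ.m⊔n≤o⇒n≤o (K ℕ.⊔ L) (M ℕ.⊔ N) m≥
            n≥MN = ℕ.m⊔n≤o⇒n≤o (K ℕ.⊔ L) (M ℕ.⊔ N) n≥
        in product-close e (seq x m) (seq y m) (seq x n) (seq y n) 0<e 0<B 0<C
             (∣x∣≤B m (ℕ.m⊔n≤o⇒m≤o K L m≥KL))
             (∣y∣≤C n (ℕ.m⊔n≤o⇒n≤o K L n≥KL))
             (p m n (ℕ.m⊔n≤o⇒m≤o M N m≥MN) (ℕ.m⊔n≤o⇒m≤o M N n≥MN))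
             (q m n (ℕ.m⊔n≤o⇒n≤o M N m≥MN) (ℕ.m⊔n≤o⇒n≤o M N n≥MN))

  _*_ : ℝ → ℝ → ℝ
  x * y = mkℝ (λ n → seq x n ℚ.* seq y n) c
    where
    c : IsCauchy (λ n → seq x n ℚ.* seq y n)
    c ε 0<ε = subst
      (λ e → ∃[ N ] ∀ m n → N ℕ.≤ m → N ℕ.≤ n →
               ℚ.∣ seq x m ℚ.* seq y m ℚ.- seq x n ℚ.* seq y n ∣ ℚ.≤ e)
      (halves ε)
      (let B , 0<B , x-bound = bound x
           C , 0<C , y-bound = bound y
       in *-cauchy x y 0<B 0<C x-bound y-bound (½ ℚ.* ε) (half-pos 0<ε))

  separated : ∀ {x} → x # 0ℝ → ∃[ δ ] 0ℚ ℚ.< δ × ∃[ N ] ∀ n → N ℕ.≤ n → δ ℚ.≤ ℚ.∣ seq x n ∣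
  separated {x} (inj₁ (δ , 0<δ , N , p)) = δ , 0<δ , N , λ n n≥ → ℚ.≤-trans
    (subst₂ ℚ._≤_
      (solve 2 (λ a d → (a :+ d) :+ :- a := d) refl (seq x n) δ)
      (ℚ.+-identityˡ (ℚ.- seq x n))
      (ℚ.+-monoˡ-≤ (ℚ.- seq x n) (p n n≥)))
    (-p≤∣p∣ (seq x n))
  separated {x} (inj₂ (δ , 0<δ , N , p)) = δ , 0<δ , N , λ n n≥ → ℚ.≤-trans
    (subst (ℚ._≤ seq x n) (ℚ.+-identityˡ δ) (p n n≥))
    (p≤∣p∣ (seq x n))

  -- Finitely many terms of a representative of x may vanish; recip sends
  -- these to 0.
  inv : (x : ℝ) → x # 0ℝ → ℝ
  inv x x#0 = mkℝ (λ n → recip (seq x n)) c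
    where
    c : IsCauchy (λ n → recip (seq x n))
    c ε 0<ε with separated {x} x#0
    ... | δ , 0<δ , K , δ≤∣x∣ with cauchy x (ε ℚ.* (δ ℚ.* δ)) (*-pos 0<ε (*-pos 0<δ 0<δ))
    ... | N , p = K ℕ.⊔ N , λ m n m≥ n≥ →
      estimate (seq x m) (seq x n)
        (δ≤∣x∣ m (ℕ.m⊔n≤o⇒m≤o K N m≥)) (δ≤∣x∣ n (ℕ.m⊔n≤o⇒m≤o K N n≥))
        (p n m (ℕ.m⊔n≤o⇒n≤o K N n≥) (ℕ.m⊔n≤o⇒n≤o K N m≥))
      where
      open ℚ.≤-Reasoning

      ≢0 : ∀ {a} → δ ℚ.≤ ℚ.∣ a ∣ → a ≢ 0ℚ
      ≢0 δ≤ refl = ℚ.<-irrefl refl (ℚ.<-≤-trans 0<δ δ≤)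

      ρ = recip δ

      0≤ρ : 0ℚ ℚ.≤ ρ
      0≤ρ = ℚ.<⇒≤ (recip-pos 0<δ)

      ∣recip∣≤ρ : ∀ {a} → δ ℚ.≤ ℚ.∣ a ∣ → ℚ.∣ recip a ∣ ℚ.≤ ρ
      ∣recip∣≤ρ {a} δ≤ = begin
        ℚ.∣ recip a ∣                          ≡⟨ sym (ℚ.*-identityʳ _) ⟩
        ℚ.∣ recip a ∣ ℚ.* 1ℚ                   ≡⟨ cong (ℚ.∣ recip a ∣ ℚ.*_) (sym (recip-inverseˡ (pos⇒≢0 0<δ))) ⟩
        ℚ.∣ recip a ∣ ℚ.* (ρ ℚ.* δ)            ≤⟨ *-mono (ℚ.0≤∣p∣ (recip a)) (*-nonNeg 0≤ρ (ℚ.0≤∣p∣ a)) ℚ.≤-refl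
                                                    (ℚ.*-monoˡ-≤-nonNeg ρ {{ℚ.nonNegative 0≤ρ}} δ≤) ⟩
        ℚ.∣ recip a ∣ ℚ.* (ρ ℚ.* ℚ.∣ a ∣)      ≡⟨ solve 3 (λ u r v → u :* (r :* v) := (u :* v) :* r)
                                                    refl ℚ.∣ recip a ∣ ρ ℚ.∣ a ∣ ⟩
        (ℚ.∣ recip a ∣ ℚ.* ℚ.∣ a ∣) ℚ.* ρ      ≡⟨ cong (ℚ._* ρ) (sym (ℚ.∣p*q∣≡∣p∣*∣q∣ (recip a) a)) ⟩
        ℚ.∣ recip a ℚ.* a ∣ ℚ.* ρ              ≡⟨ cong (λ u → ℚ.∣ u ∣ ℚ.* ρ) (recip-inverseˡ (≢0 δ≤)) ⟩
        1ℚ ℚ.* ρ                               ≡⟨ ℚ.*-identityˡ ρ ⟩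
        ρ                                      ∎

      difference : ∀ {a b} → a ≢ 0ℚ → b ≢ 0ℚ →
                   recip a ℚ.- recip b ≡ (b ℚ.- a) ℚ.* (recip a ℚ.* recip b)
      difference {a} {b} a≢0 b≢0 = sym (trans
        (solve 4 (λ a b r s → (b :- a) :* (r :* s) := (s :* b) :* r :- (r :* a) :* s)
          refl a b (recip a) (recip b))
        (cong₂ (λ u v → u ℚ.- v)
          (trans (cong (ℚ._* recip a) (recip-inverseˡ b≢0)) (ℚ.*-identityˡ (recip a)))
          (trans (cong (ℚ._* recip b) (recip-inverseˡ a≢0)) (ℚ.*-identityˡ (recip b)))))

      estimate : ∀ a b → δ ℚ.≤ ℚ.∣ a ∣ → δ ℚ.≤ ℚ.∣ b ∣ →
                 ℚ.∣ b ℚ.- a ∣ ℚ.≤ ε ℚ.* (δ ℚ.* δ) → ℚ.∣ recip a ℚ.- recip b ∣ ℚ.≤ ε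
      estimate a b a≥ b≥ d = begin
        ℚ.∣ recip a ℚ.- recip b ∣                        ≡⟨ cong ℚ.∣_∣ (difference (≢0 a≥) (≢0 b≥)) ⟩
        ℚ.∣ (b ℚ.- a) ℚ.* (recip a ℚ.* recip b) ∣        ≡⟨ ℚ.∣p*q∣≡∣p∣*∣q∣ (b ℚ.- a) _ ⟩
        ℚ.∣ b ℚ.- a ∣ ℚ.* ℚ.∣ recip a ℚ.* recip b ∣      ≡⟨ cong (ℚ.∣ b ℚ.- a ∣ ℚ.*_) (ℚ.∣p*q∣≡∣p∣*∣q∣ (recip a) (recip b)) ⟩
        ℚ.∣ b ℚ.- a ∣ ℚ.* (ℚ.∣ recip a ∣ ℚ.* ℚ.∣ recip b ∣)
          ≤⟨ *-mono (ℚ.0≤∣p∣ (b ℚ.- a)) (*-nonNeg 0≤ρ 0≤ρ) d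
               (*-mono (ℚ.0≤∣p∣ (recip a)) 0≤ρ (∣recip∣≤ρ a≥) (∣recip∣≤ρ b≥)) ⟩
        ε ℚ.* (δ ℚ.* δ) ℚ.* (ρ ℚ.* ρ)                    ≡⟨ solve 3 (λ e d r → e :* (d :* d) :* (r :* r) := e :* ((r :* d) :* (r :* d)))
                                                             refl ε δ ρ ⟩
        ε ℚ.* ((ρ ℚ.* δ) ℚ.* (ρ ℚ.* δ))                  ≡⟨ cong (λ u → ε ℚ.* (u ℚ.* u)) (recip-inverseˡ (pos⇒≢0 0<δ)) ⟩
        ε ℚ.* 1ℚ                                         ≡⟨ ℚ.*-identityʳ ε ⟩
        ε                                                ∎

  abstract
    roots-cauchy : (x : ℝ) (s : ℕ → ℚ) → (∀ n → IsRoot (seq x n) (mesh n) (s n)) →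
                   ∀ h → 0ℚ ℚ.< h → ∃[ N ] ∀ m n → N ℕ.≤ m → N ℕ.≤ n →
                   ℚ.∣ s m ℚ.- s n ∣ ℚ.≤ h ℚ.+ h
    roots-cauchy x s r h 0<h with mesh-small 0<h | cauchy x (h ℚ.* h) (*-pos 0<h 0<h)
    ... | M , small | N , p = M ℕ.⊔ N , λ m n m≥ n≥ → ∣p∣≤-intro
        (one-sided m n m≥ n≥)
        (subst (ℚ._≤ h ℚ.+ h) (swap-minus (s n) (s m)) (one-sided n m n≥ m≥))
      where
      one-sided : ∀ m n → M ℕ.⊔ N ℕ.≤ m → M ℕ.⊔ N ℕ.≤ n → s m ℚ.- s n ℚ.≤ h ℚ.+ h
      one-sided m n m≥ n≥ = root-close h 0<h (r m) (r n)
        (mesh-pos n) (small n (ℕ.m⊔n≤o⇒m≤o M N n≥))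
        (ℚ.≤-trans (p≤∣p∣ (seq x m ℚ.- seq x n))
          (p m n (ℕ.m⊔n≤o⇒n≤o M N m≥) (ℕ.m⊔n≤o⇒n≤o M N n≥)))

  -- The n-th term is a rational s ≥ 0 with s² ≤ xₙ < (s + 1/(n+1))².
  sqrt : (x : ℝ) → (∀ n → 0ℚ ℚ.≤ seq x n) → ℝ
  sqrt x 0≤x = mkℝ s λ ε 0<ε → subst
    (λ e → ∃[ N ] ∀ m n → N ℕ.≤ m → N ℕ.≤ n → ℚ.∣ s m ℚ.- s n ∣ ℚ.≤ e)
    (halves ε) (roots-cauchy x s (λ n → proj₂ (r n)) (½ ℚ.* ε) (half-pos 0<ε))
    where
    r : ∀ n → Σ ℚ (IsRoot (seq x n) (mesh n))
    r n = root (0≤x n) (mesh-pos n)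

    s : ℕ → ℚ
    s n = proj₁ (r n)

open Real public using (0ℝ; 1ℝ)

record ℂ : Set where
  constructor _+i_
  field
    re im : ℝ

open ℂ public

fromℝ : ℝ → ℂ
fromℝ x = x +i 0ℝ

module Complex where

  infix  4 _≈_ _#_
  infixl 6 _+_ _-_
  infixl 7 _*_ _/_[_]
  infix  8 -_

  _≈_ : ℂ → ℂ → Set
  z ≈ w = re z Real.≈ re w × im z Real.≈ im w

  _#_ : ℂ → ℂ → Set
  z # w = re z Real.# re w ⊎ im z Real.# im w

  0ℂ 1ℂ : ℂ
  0ℂ = fromℝ 0ℝ
  1ℂ = fromℝ 1ℝ

  _+_ : ℂ → ℂ → ℂ
  z + w = (re z Real.+ re w) +i (im z Real.+ im w)

  -_ : ℂ → ℂ
  - z = (Real.- re z) +i (Real.- im z)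

  _-_ : ℂ → ℂ → ℂ
  z - w = z + (- w)

  _*_ : ℂ → ℂ → ℂ
  z * w = (re z Real.* re w Real.+ Real.- (im z Real.* im w))
       +i (re z Real.* im w Real.+ im z Real.* re w)

  normSq : ℂ → ℝ
  normSq z = re z Real.* re z Real.+ im z Real.* im z

  normSq-nonNeg : ∀ z n → 0ℚ ℚ.≤ seq (normSq z) n
  normSq-nonNeg z n = subst (ℚ._≤ seq (normSq z) n) (ℚ.+-identityˡ 0ℚ)
    (ℚ.+-mono-≤ (Estimates.0≤p² (seq (re z) n)) (Estimates.0≤p² (seq (im z) n)))

  ∣_∣ : ℂ → ℝ
  ∣ z ∣ = Real.sqrt (normSq z) (normSq-nonNeg z)

  normSq-pos : ∀ z → z # 0ℂ → 0ℝ Real.< normSq z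
  normSq-pos z (inj₁ x#0) with Real.separated {re z} x#0
  ... | δ , 0<δ , N , p = δ ℚ.* δ , *-pos 0<δ 0<δ , N , λ n n≥ → begin
      0ℚ ℚ.+ δ ℚ.* δ                   ≡⟨ ℚ.+-comm 0ℚ (δ ℚ.* δ) ⟩
      δ ℚ.* δ ℚ.+ 0ℚ                   ≤⟨ ℚ.+-mono-≤ (square-mono (ℚ.<⇒≤ 0<δ) (p n n≥)) (0≤p² (seq (im z) n)) ⟩
      seq (normSq z) n                 ∎
    where
    open ℚ.≤-Reasoning
    open Estimates
  normSq-pos z (inj₂ y#0) with Real.separated {im z} y#0
  ... | δ , 0<δ , N , p = δ ℚ.* δ , *-pos 0<δ 0<δ , N , λ n n≥ →
      ℚ.+-mono-≤ (0≤p² (seq (re z) n)) (square-mono (ℚ.<⇒≤ 0<δ) (p n n≥))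
    where open Estimates

  inv : (z : ℂ) → z # 0ℂ → ℂ
  inv z z#0 = (re z Real.* N⁻¹) +i (Real.- im z Real.* N⁻¹)
    where N⁻¹ = Real.inv (normSq z) (inj₂ (normSq-pos z z#0))

  _/_[_] : (z w : ℂ) → w # 0ℂ → ℂ
  z / w [ w#0 ] = z * inv w w#0

open Complex

-- Partial maps on representatives: value may depend on the proof that z lies
-- in the domain.  Partial functions on ℂ are the extensional ones.
record PartialMap : Set₁ where
  field
    Dom   : ℂ → Set
    value : ∀ z → Dom z → ℂ

open PartialMap public

record Extensional (f : PartialMap) : Set where
  field
    dom-resp   : ∀ {z w} → z ≈ w → Dom f z → Dom f w
    value-cong : ∀ {z w} → z ≈ w → (p : Dom f z) (q : Dom f w) → value f z p ≈ value f w q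

infix 4 _[_]=_
_[_]=_ : PartialMap → ℂ → ℂ → Set
f [ z ]= v = Dom f z × (∀ p → value f z p ≈ v)

absMap : PartialMap → PartialMap
absMap f = record
  { Dom   = Dom f
  ; value = λ z p → fromℝ ∣ value f z p ∣
  }

_∈[_,_] : ℝ → ℝ → ℝ → Set
x ∈[ α , β ] = α Real.≤ x × x Real.≤ β

DefinedOn : PartialMap → ℝ → ℝ → Set
DefinedOn f α β = ∀ x → x ∈[ α , β ] → Dom f (fromℝ x)

-- The first component makes a a limit point of the domain, so that there
-- is at most one limit.
IsLimit : PartialMap → ℂ → ℂ → Set
IsLimit f a L =
    (∀ δ → 0ℝ Real.< δ → ∃[ z ] z # a × ∣ z - a ∣ Real.< δ × Dom f z)
  × (∀ ε → 0ℝ Real.< ε → ∃[ δ ] 0ℝ Real.< δ ×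
      (∀ z (p : Dom f z) → z # a → ∣ z - a ∣ Real.< δ → ∣ value f z p - L ∣ Real.< ε))

-- Continuity at a of the restriction of f to [α , β].
ContinuousAt : PartialMap → ℝ → ℝ → ℝ → Set
ContinuousAt f α β a =
  ∀ (q : Dom f (fromℝ a)) ε → 0ℝ Real.< ε → ∃[ δ ] 0ℝ Real.< δ ×
    (∀ x → x ∈[ α , β ] → (p : Dom f (fromℝ x)) → ∣ fromℝ x - fromℝ a ∣ Real.< δ →
      ∣ value f (fromℝ x) p - value f (fromℝ a) q ∣ Real.< ε)

-- The λ-derivative of f at 0 is a limit of values of f away from 0, so it does
-- not determine f(0): for λ = 1, f(0) = 1 and f(x) = x for x ≠ 0, it is
-- constantly 1 on [0 , 1] and integrates to 1, whereas f(1) - f(0) = 0.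
-- When 0 is an endpoint, f must therefore be continuous there.
ContinuousAtZeroEndpoint : PartialMap → ℝ → ℝ → Set
ContinuousAtZeroEndpoint f α β = α Real.≈ 0ℝ ⊎ β Real.≈ 0ℝ → ContinuousAt f α β 0ℝ

module LambdaCalculus (lam : ℂ) (lam#0 : lam # 0ℂ) where

  quotient : PartialMap → PartialMap
  quotient f = record
    { Dom   = λ z → z # 0ℂ × Dom f (lam * z)
    ; value = λ z (z#0 , p) → value f (lam * z) p / z [ z#0 ]
    }

  -- The limit at 0 runs over all complex z # 0 with lam * z in the domain of f.
  -- Two implications rather than a disjunction: whether a complex number
  -- is zero is undecidable.
  IsDerivative : PartialMap → ℂ → ℂ → Set
  IsDerivative f z v =
      (z # 0ℂ → quotient f [ z ]= v)
    × (z ≈ 0ℂ → IsLimit (quotient f) 0ℂ v)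

  𝐃 : PartialMap → PartialMap
  𝐃 f = record
    { Dom   = λ z → ∃[ v ] IsDerivative f z v
    ; value = λ _ → proj₁
    }

  infixl 8 _/λ
  _/λ : ℂ → ℂ
  z /λ = z / lam [ lam#0 ]

  ∫₀ : (f : PartialMap) (x : ℂ) → Dom f (x /λ) → ℂ
  ∫₀ f x p = (x /λ) * value f (x /λ) p

  -- The endpoints are complex because 𝐃 evaluates y ↦ ∫ f α y at lam * y.
  Integrable : PartialMap → ℂ → ℂ → Set
  Integrable f α β = Dom f (α /λ) × Dom f (β /λ)

  ∫ : (f : PartialMap) (α β : ℂ) → Integrable f α β → ℂ
  ∫ f α β (p , q) = ∫₀ f β q - ∫₀ f α p

  integralFrom : PartialMap → ℂ → PartialMap
  integralFrom f α = record
    { Dom   = Integrable f α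
    ; value = ∫ f α
    }

  -- ∫ |f| < ∞ amounts to the existence of the integral, whose value is an
  -- algebraic expression in two values of |f|.
  𝓛¹ : ℝ → ℝ → PartialMap → Set
  𝓛¹ α β f = DefinedOn f α β × Integrable (absMap f) (fromℝ α) (fromℝ β)

{-# OPTIONS --safe #-}

-- Away from 0 both parts are cancellations: λ (z / λ) = z = (λ z) / λ, and
-- (z / λ) (𝐃 f) (z / λ) = f (λ (z / λ)) = f z.  An endpoint at 0 contributes
-- 0 to the integral, so that f 0 = 0 is needed there: f t is t / λ times a
-- difference quotient with a limit at 0, hence f t → 0 as t → 0 within the
-- interval, and f is continuous at 0.  The case distinctions (endpoint zero or
-- not, α < β or α = β) are available because equality is ¬¬-stable.
module Submission where

open import Defs
open import Data.Product using (_×_; ∃-syntax; _,_; proj₁; proj₂)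

open import Algebra.Bundles using (CommutativeRing)
open import Algebra.Structures using (IsGroup; IsCommutativeRing)
open import Data.Nat.Base as ℕ using (ℕ)
import Data.Nat.Properties as ℕ
open import Data.Integer.Base using (+_)
open import Data.Rational.Base as ℚ using (ℚ; 0ℚ; 1ℚ; ½)
import Data.Rational.Properties as ℚ
open import Data.Rational.Solver using (module +-*-Solver)
open import Data.Sum using (_⊎_; inj₁; inj₂)
open import Function using (_∘_; const)
open import Level using (0ℓ)
open import Relation.Binary.PropositionalEquality
  using (_≡_; refl; sym; trans; cong; cong₂; subst; subst₂)
open import Relation.Nullary using (¬_; yes; no; contradiction)

open +-*-Solver
open Estimates

-- Every value of `𝐃 f` comes with two implications, one for points apart from 0 and one for points
-- equal to 0, and for an endpoint divided by λ neither premise can be decided. Both branches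
-- therefore have to reach the same equation, after which tightness of apartness removes the case
-- distinction. The case α = β has its own argument because the interval may be {0}: no other point
-- of it approaches 0, continuity there says nothing, and f 0 may be nonzero although the complex
-- limit exists. The formula survives because both of its sides are differences of equal numbers.
-- Limits and continuity are stated with the modulus, whose terms are only approximate square roots.
-- The estimates are carried out with the componentwise rational bounds of `≲` instead, and `∣∣<⇒≲`
-- and `≲⇒∣∣<` translate between the two. Approaching 0 along rational points of the interval keeps
-- these estimates inside ℚ.

Eventually : (ℕ → Set) → Set
Eventually P = ∃[ N ] ∀ n → N ℕ.≤ n → P n

map-ev : ∀ {P Q : ℕ → Set} → (∀ n → P n → Q n) → Eventually P → Eventually Q
map-ev h (N , p) = N , λ n n≥ → h n (p n n≥)

zip-ev : ∀ {P Q R : ℕ → Set} → (∀ n → P n → Q n → R n) →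
         Eventually P → Eventually Q → Eventually R
zip-ev h (M , p) (N , q) = M ℕ.⊔ N , λ n n≥ →
  h n (p n (ℕ.m⊔n≤o⇒m≤o M N n≥)) (q n (ℕ.m⊔n≤o⇒n≤o M N n≥))

ev-const : ∀ {A : Set} → Eventually (const A) → A
ev-const (N , a) = a N ℕ.≤-refl

-- An inequality depends only on the difference of its sides. A linear consequence of known
-- inequalities thus becomes their sum together with a ring identity for the solver.
≤-by : ∀ {u v p q} → u ℚ.≤ v → v ℚ.- u ≡ q ℚ.- p → p ℚ.≤ q
≤-by {u} {v} {p} {q} u≤v eq = subst₂ ℚ._≤_
  (solve 2 (λ u p → u :+ (p :- u) := p) refl u p)
  (trans (solve 3 (λ u v p → v :+ (p :- u) := p :+ (v :- u)) refl u v p)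
    (trans (cong (p ℚ.+_) eq) (solve 2 (λ p q → p :+ (q :- p) := q) refl p q)))
  (ℚ.+-monoˡ-≤ (p ℚ.- u) u≤v)

pos≰0 : ∀ {ε} → 0ℚ ℚ.< ε → ¬ (ε ℚ.≤ 0ℚ)
pos≰0 0<ε ε≤0 = ℚ.<-irrefl refl (ℚ.<-≤-trans 0<ε ε≤0)

sum-pos : ∀ {p q} → 0ℚ ℚ.< p → 0ℚ ℚ.< q → 0ℚ ℚ.< p ℚ.+ q
sum-pos 0<p 0<q = +-pos 0<p (ℚ.<⇒≤ 0<q)

-- The radius of each later estimate, taken as the minimum of u and w / C. Here `C` is twice a bound
-- on the other factor of a complex product, whose components are sums of two real products, or 1
-- when `d` merely has to stay below two numbers.
shrink : ∀ {u w C} → 0ℚ ℚ.< u → 0ℚ ℚ.< w → 0ℚ ℚ.< C →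
         ∃[ d ] 0ℚ ℚ.< d × d ℚ.≤ u × d ℚ.* C ℚ.≤ w
shrink {u} {w} {C} 0<u 0<w 0<C =
  u ℚ.⊓ r , 0<min , ℚ.p⊓q≤p u r ,
  ℚ.≤-trans (ℚ.*-monoʳ-≤-nonNeg C {{ℚ.nonNegative (ℚ.<⇒≤ 0<C)}} (ℚ.p⊓q≤q u r))
    (ℚ.≤-reflexive (trans (ℚ.*-comm r C) (cancel-recip w 0<C)))
  where
  r : ℚ
  r = w ℚ.* recip C
  0<min : 0ℚ ℚ.< u ℚ.⊓ r
  0<min with ℚ.⊓-sel u r
  ... | inj₁ eq = subst (0ℚ ℚ.<_) (sym eq) 0<u
  ... | inj₂ eq = subst (0ℚ ℚ.<_) (sym eq) (*-pos 0<w (recip-pos 0<C))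

-- The operations are parameters, since terms built from the operations of ℂ are
-- expensive to compare once unfolded.
module InverseIdentities
  {A : Set} (_≈_ : A → A → Set) (_+_ _*_ : A → A → A) (-_ : A → A) (0# 1# : A)
  (isCommutativeRing : IsCommutativeRing _≈_ _+_ _*_ -_ 0# 1#)
  (w w⁻¹ : A) (inverseˡ : (w⁻¹ * w) ≈ 1#)
  where

  private
    R : CommutativeRing 0ℓ 0ℓ
    R = record { isCommutativeRing = isCommutativeRing }

  open CommutativeRing R using (ring; setoid; *-comm; *-assoc; *-congˡ; *-identityˡ; *-identityʳ;
                                distribʳ; +-cong; +-congˡ; -‿cong)
    renaming (trans to ≈-trans; sym to ≈-sym)
  open import Algebra.Properties.Ring ring using (-‿distribˡ-*)
  open import Relation.Binary.Reasoning.Setoid setoid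

  cancel-inside : ∀ z → (w * (z * w⁻¹)) ≈ z
  cancel-inside z = begin
    w * (z * w⁻¹)    ≈⟨ *-comm w (z * w⁻¹) ⟩
    (z * w⁻¹) * w    ≈⟨ *-assoc z w⁻¹ w ⟩
    z * (w⁻¹ * w)    ≈⟨ *-congˡ inverseˡ ⟩
    z * 1#           ≈⟨ *-identityʳ z ⟩
    z                ∎

  cancel-outside : ∀ z → ((w * z) * w⁻¹) ≈ z
  cancel-outside z = ≈-trans (*-assoc w z w⁻¹) (cancel-inside z)

  -- The algebra of part 1: `w` is the point of evaluation, `z` the value of f there, `u` the
  -- contribution of the lower limit, and `1# * w⁻¹` the form that `1ℂ / z` takes when unfolded.
  cancel-difference : ∀ z u → (((w * z) + (- u)) * w⁻¹) ≈ (z + (- (u * (1# * w⁻¹))))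
  cancel-difference z u = begin
    ((w * z) + (- u)) * w⁻¹            ≈⟨ distribʳ w⁻¹ (w * z) (- u) ⟩
    ((w * z) * w⁻¹) + ((- u) * w⁻¹)    ≈⟨ +-cong (cancel-outside z) (≈-sym (-‿distribˡ-* u w⁻¹)) ⟩
    z + (- (u * w⁻¹))                  ≈⟨ +-congˡ (-‿cong (*-congˡ (*-identityˡ w⁻¹))) ⟨
    z + (- (u * (1# * w⁻¹)))           ∎

-- Equality, order and apartness of Cauchy reals

module Reals where

  open Real

  ev-≡⇒≈ : ∀ x y → Eventually (λ n → seq x n ≡ seq y n) → x ≈ y
  ev-≡⇒≈ x y eq ε 0<ε = map-ev
    (λ n e → subst (ℚ._≤ ε)
      (sym (cong ℚ.∣_∣ (trans (cong (ℚ._- seq y n) e) (ℚ.+-inverseʳ (seq y n)))))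
      (ℚ.<⇒≤ 0<ε)) eq

  ≡⇒≈ : ∀ x y → (∀ n → seq x n ≡ seq y n) → x ≈ y
  ≡⇒≈ x y eq = ev-≡⇒≈ x y (0 , λ n _ → eq n)

  ≈-sym : ∀ x y → x ≈ y → y ≈ x
  ≈-sym x y p ε 0<ε = map-ev
    (λ n → subst (ℚ._≤ ε) (trans (cong ℚ.∣_∣ (swap-minus (seq x n) (seq y n)))
                                 (ℚ.∣-p∣≡∣p∣ (seq y n ℚ.- seq x n))))
    (p ε 0<ε)

  +-estimate : ∀ a b {d e} → ℚ.∣ a ∣ ℚ.≤ d → ℚ.∣ b ∣ ℚ.≤ e → ℚ.∣ a ℚ.+ b ∣ ℚ.≤ d ℚ.+ e
  +-estimate a b p q = ℚ.≤-trans (ℚ.∣p+q∣≤∣p∣+∣q∣ a b) (ℚ.+-mono-≤ p q)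

  ≈-trans : ∀ x y z → x ≈ y → y ≈ z → x ≈ z
  ≈-trans x y z p q ε 0<ε = zip-ev
    (λ n d e → subst₂ ℚ._≤_
      (cong ℚ.∣_∣ (solve 3 (λ a b c → (a :- b) :+ (b :- c) := a :- c) refl
                    (seq x n) (seq y n) (seq z n)))
      (halves ε)
      (+-estimate (seq x n ℚ.- seq y n) (seq y n ℚ.- seq z n) d e))
    (p (½ ℚ.* ε) (half-pos 0<ε)) (q (½ ℚ.* ε) (half-pos 0<ε))

  +-cong : ∀ x x′ y y′ → x ≈ x′ → y ≈ y′ → x + y ≈ x′ + y′
  +-cong x x′ y y′ p q ε 0<ε = zip-ev
    (λ n d e → subst₂ ℚ._≤_
      (cong ℚ.∣_∣ (solve 4 (λ a a′ b b′ → (a :- a′) :+ (b :- b′) := (a :+ b) :- (a′ :+ b′)) refl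
                    (seq x n) (seq x′ n) (seq y n) (seq y′ n)))
      (halves ε)
      (+-estimate (seq x n ℚ.- seq x′ n) (seq y n ℚ.- seq y′ n) d e))
    (p (½ ℚ.* ε) (half-pos 0<ε)) (q (½ ℚ.* ε) (half-pos 0<ε))

  -‿cong : ∀ x y → x ≈ y → - x ≈ - y
  -‿cong x y p ε 0<ε = map-ev
    (λ n → subst (ℚ._≤ ε) (cong ℚ.∣_∣
      (solve 2 (λ a b → b :- a := :- a :- :- b) refl (seq x n) (seq y n))))
    (≈-sym x y p ε 0<ε)

  -- The difference splits as x (y - y′) + y′ (x - x′), so `x` and `y′` are the two factors that get
  -- bounded.
  *-cong : ∀ x x′ y y′ → x ≈ x′ → y ≈ y′ → x * y ≈ x′ * y′
  *-cong x x′ y y′ p q ε 0<ε = subst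
    (λ e → Eventually (λ n → ℚ.∣ seq (x * y) n ℚ.- seq (x′ * y′) n ∣ ℚ.≤ e))
    (halves ε)
    (combine (bound x) (bound y′))
    where
    e : ℚ
    e = ½ ℚ.* ε

    0<e : 0ℚ ℚ.< e
    0<e = half-pos 0<ε

    combine : ∃[ B ] 0ℚ ℚ.< B × Eventually (λ n → ℚ.∣ seq x n ∣ ℚ.≤ B) →
              ∃[ C ] 0ℚ ℚ.< C × Eventually (λ n → ℚ.∣ seq y′ n ∣ ℚ.≤ C) →
              Eventually (λ n → ℚ.∣ seq (x * y) n ℚ.- seq (x′ * y′) n ∣ ℚ.≤ e ℚ.+ e)
    combine (B , 0<B , x≤B) (C , 0<C , y′≤C) = zip-ev
      (λ n (a≤ , da) (b≤ , db) →
        product-close e (seq x n) (seq y n) (seq x′ n) (seq y′ n) 0<e 0<B 0<C a≤ b≤ da db)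
      (zip-ev (λ _ → _,_) x≤B (p (e ℚ.* recip C) (*-pos {e} {recip C} 0<e (recip-pos 0<C))))
      (zip-ev (λ _ → _,_) y′≤C (q (e ℚ.* recip B) (*-pos {e} {recip B} 0<e (recip-pos 0<B))))

  recip-inverse : ∀ x → x # 0ℝ → Eventually (λ n → recip (seq x n) ℚ.* seq x n ≡ 1ℚ)
  recip-inverse x x#0 with separated {x} x#0
  ... | δ , 0<δ , δ≤∣x∣ = map-ev (λ n δ≤ → recip-inverseˡ λ x≡0 →
    pos≰0 0<δ (subst (λ a → δ ℚ.≤ ℚ.∣ a ∣) x≡0 δ≤)) δ≤∣x∣

  ev-≤⇒≤ : ∀ x y → Eventually (λ n → seq x n ℚ.≤ seq y n) → x ≤ y
  ev-≤⇒≤ x y x≤y (ε , 0<ε , y+ε≤x) = pos≰0 0<ε (ev-const (zip-ev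
    (λ n p q → ≤-by (ℚ.+-mono-≤ p q)
      (solve 3 (λ a b e → (b :+ a) :- (a :+ (b :+ e)) := con 0ℚ :- e) refl
        (seq x n) (seq y n) ε))
    x≤y y+ε≤x))

  ≈⇒≮ : ∀ x y → x ≈ y → ¬ (x < y)
  ≈⇒≮ x y x≈y (ε , 0<ε , x+ε≤y) = pos≰0 (half-pos 0<ε) (ev-const (zip-ev
    (λ n p q → ≤-by (ℚ.+-mono-≤ p (ℚ.≤-trans (-p≤∣p∣ (seq x n ℚ.- seq y n)) q))
      (solve 3 (λ a b e → (b :+ con ½ :* e) :- ((a :+ e) :+ :- (a :- b))
                          := con 0ℚ :- con ½ :* e) refl
        (seq x n) (seq y n) ε))
    x+ε≤y (x≈y (½ ℚ.* ε) (half-pos 0<ε))))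

  ≈⇒¬# : ∀ x y → x ≈ y → ¬ (x # y)
  ≈⇒¬# x y x≈y (inj₁ x<y) = ≈⇒≮ x y x≈y x<y
  ≈⇒¬# x y x≈y (inj₂ y<x) = ≈⇒≮ y x (≈-sym x y x≈y) y<x

  private
    -- With e = ε/5, comparing the distance of two fixed terms with 3e settles both outcomes: later
    -- terms of either number drift by at most e, so a distance of at most 3e grows to at most 5e =
    -- ε, and one above 3e stays at least e.
    fifth : ℚ
    fifth = + 1 ℚ./ 5

    gap : ∀ a b a′ b′ e → ℚ.∣ a ℚ.- a′ ∣ ℚ.≤ e → ℚ.∣ b ℚ.- b′ ∣ ℚ.≤ e →
          e ℚ.+ e ℚ.+ e ℚ.≤ b ℚ.- a → a′ ℚ.+ e ℚ.≤ b′
    gap a b a′ b′ e da db g = ≤-by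
      (ℚ.+-mono-≤ (ℚ.+-mono-≤ (ℚ.≤-trans (-p≤∣p∣ (a ℚ.- a′)) da)
                               (ℚ.≤-trans (p≤∣p∣ (b ℚ.- b′)) db)) g)
      (solve 5 (λ a b a′ b′ e →
          ((e :+ e) :+ (b :- a)) :- ((:- (a :- a′) :+ (b :- b′)) :+ (e :+ e :+ e))
          := b′ :- (a′ :+ e)) refl a b a′ b′ e)

  -- Decided by the rational distance of two sufficiently late terms.
  #⊎close : ∀ x y ε → 0ℚ ℚ.< ε → x # y ⊎ Eventually (λ n → ℚ.∣ seq x n ℚ.- seq y n ∣ ℚ.≤ ε)
  #⊎close x y ε 0<ε = decide (ℚ.∣ xN ℚ.- yN ∣ ℚ.≤? e ℚ.+ e ℚ.+ e)
    where
    e : ℚ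
    e = fifth ℚ.* ε

    0<e : 0ℚ ℚ.< e
    0<e = *-pos (ℚ.positive⁻¹ fifth) 0<ε

    tail : ∃[ N ] ∀ m n → N ℕ.≤ m → N ℕ.≤ n →
           ℚ.∣ seq x m ℚ.- seq x n ∣ ℚ.≤ e × ℚ.∣ seq y m ℚ.- seq y n ∣ ℚ.≤ e
    tail with cauchy x e 0<e | cauchy y e 0<e
    ... | M , p | N , q = M ℕ.⊔ N , λ m n m≥ n≥ →
      p m n (ℕ.m⊔n≤o⇒m≤o M N m≥) (ℕ.m⊔n≤o⇒m≤o M N n≥) ,
      q m n (ℕ.m⊔n≤o⇒n≤o M N m≥) (ℕ.m⊔n≤o⇒n≤o M N n≥)

    N : ℕ
    N = proj₁ tail

    xN yN : ℚ
    xN = seq x N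
    yN = seq y N

    near : ∀ n → N ℕ.≤ n → ℚ.∣ xN ℚ.- seq x n ∣ ℚ.≤ e × ℚ.∣ yN ℚ.- seq y n ∣ ℚ.≤ e
    near n = proj₂ tail N n ℕ.≤-refl

    decide : _ → x # y ⊎ Eventually (λ n → ℚ.∣ seq x n ℚ.- seq y n ∣ ℚ.≤ ε)
    decide (yes close) = inj₂ (N , λ n n≥ → subst₂ ℚ._≤_
      (cong ℚ.∣_∣ (solve 4 (λ a b a′ b′ → (:- (a :- a′) :+ (b :- b′)) :+ (a :- b) := a′ :- b′) refl
                    xN yN (seq x n) (seq y n)))
      (solve 1 (λ ε → let e = con fifth :* ε in (e :+ e) :+ (e :+ e :+ e) := ε) refl ε)
      (+-estimate (ℚ.- (xN ℚ.- seq x n) ℚ.+ (yN ℚ.- seq y n)) (xN ℚ.- yN)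
        (+-estimate (ℚ.- (xN ℚ.- seq x n)) (yN ℚ.- seq y n)
          (subst (ℚ._≤ e) (sym (ℚ.∣-p∣≡∣p∣ (xN ℚ.- seq x n))) (proj₁ (near n n≥)))
          (proj₂ (near n n≥)))
        close))
    decide (no far) with ℚ.∣p∣≡p∨∣p∣≡-p (xN ℚ.- yN)
    ... | inj₁ eq = inj₁ (inj₂ (e , 0<e , N , λ n n≥ →
      gap yN xN (seq y n) (seq x n) e (proj₂ (near n n≥)) (proj₁ (near n n≥))
        (subst (_ ℚ.≤_) eq (ℚ.<⇒≤ (ℚ.≰⇒> far)))))
    ... | inj₂ eq = inj₁ (inj₁ (e , 0<e , N , λ n n≥ →
      gap xN yN (seq x n) (seq y n) e (proj₁ (near n n≥)) (proj₂ (near n n≥))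
        (subst (_ ℚ.≤_) (trans eq (sym (swap-minus yN xN))) (ℚ.<⇒≤ (ℚ.≰⇒> far)))))

  -- For each ε, `#⊎close` leaves only closeness once apartness is refuted. The stability of
  -- equality rests on this.
  ¬#⇒≈ : ∀ x y → ¬ (x # y) → x ≈ y
  ¬#⇒≈ x y ¬# ε 0<ε with #⊎close x y ε 0<ε
  ... | inj₁ x#y   = contradiction x#y ¬#
  ... | inj₂ close = close

-- The commutative ring of complex numbers and its inverses

open Complex

infix 4 _≃_

-- Complex._≈_ as a record: unlike the unfolding definition, it lets Agda infer
-- the two numbers from a proof.
record _≃_ (z w : ℂ) : Set where
  constructor ⟪_⟫
  field
    ≈-of : z ≈ w

open _≃_

≡⇒≃ : ∀ {z w} → (∀ n → seq (re z) n ≡ seq (re w) n) → (∀ n → seq (im z) n ≡ seq (im w) n) → z ≃ w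
≡⇒≃ {z} {w} p q = ⟪ Reals.≡⇒≈ (re z) (re w) p , Reals.≡⇒≈ (im z) (im w) q ⟫

≃-refl : ∀ {z} → z ≃ z
≃-refl = ≡⇒≃ (λ _ → refl) (λ _ → refl)

≃-sym : ∀ {z w} → z ≃ w → w ≃ z
≃-sym {z} {w} ⟪ p , q ⟫ = ⟪ Reals.≈-sym (re z) (re w) p , Reals.≈-sym (im z) (im w) q ⟫

≃-trans : ∀ {z w u} → z ≃ w → w ≃ u → z ≃ u
≃-trans {z} {w} {u} ⟪ p , q ⟫ ⟪ p′ , q′ ⟫ =
  ⟪ Reals.≈-trans (re z) (re w) (re u) p p′ , Reals.≈-trans (im z) (im w) (im u) q q′ ⟫

+-cong : ∀ z z′ w w′ → z ≃ z′ → w ≃ w′ → z + w ≃ z′ + w′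
+-cong z z′ w w′ ⟪ p , q ⟫ ⟪ p′ , q′ ⟫ =
  ⟪ Reals.+-cong (re z) (re z′) (re w) (re w′) p p′ , Reals.+-cong (im z) (im z′) (im w) (im w′) q q′ ⟫

-‿cong : ∀ z w → z ≃ w → - z ≃ - w
-‿cong z w ⟪ p , q ⟫ = ⟪ Reals.-‿cong (re z) (re w) p , Reals.-‿cong (im z) (im w) q ⟫

*-cong : ∀ z z′ w w′ → z ≃ z′ → w ≃ w′ → z * w ≃ z′ * w′
*-cong (a +i b) (a′ +i b′) (c +i d) (c′ +i d′) ⟪ p , q ⟫ ⟪ r , s ⟫ =
  ⟪ Reals.+-cong (a ·  c) (a′ · c′) (Real.- (b · d)) (Real.- (b′ · d′))
      (Reals.*-cong a a′ c c′ p r)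
      (Reals.-‿cong (b · d) (b′ · d′) (Reals.*-cong b b′ d d′ q s))
  , Reals.+-cong (a · d) (a′ · d′) (b · c) (b′ · c′)
      (Reals.*-cong a a′ d d′ p s) (Reals.*-cong b b′ c c′ q r) ⟫
  where
  _·_ : ℝ → ℝ → ℝ
  _·_ = Real._*_

-- Ring identities hold termwise for the representing sequences.
+-0-isGroup : IsGroup _≃_ _+_ 0ℂ (-_)
+-0-isGroup = record
  { isMonoid = record
    { isSemigroup = record
      { isMagma = record
        { isEquivalence = record { refl = ≃-refl ; sym = ≃-sym ; trans = ≃-trans }
        ; ∙-cong = λ {z} {z′} {w} {w′} → +-cong z z′ w w′ }
      ; assoc = λ z w u → ≡⇒≃
          (λ n → ℚ.+-assoc (seq (re z) n) (seq (re w) n) (seq (re u) n))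
          (λ n → ℚ.+-assoc (seq (im z) n) (seq (im w) n) (seq (im u) n)) }
    ; identity =
        (λ z → ≡⇒≃ (λ n → ℚ.+-identityˡ (seq (re z) n)) (λ n → ℚ.+-identityˡ (seq (im z) n)))
      , (λ z → ≡⇒≃ (λ n → ℚ.+-identityʳ (seq (re z) n)) (λ n → ℚ.+-identityʳ (seq (im z) n))) }
  ; inverse =
      (λ z → ≡⇒≃ (λ n → ℚ.+-inverseˡ (seq (re z) n)) (λ n → ℚ.+-inverseˡ (seq (im z) n)))
    , (λ z → ≡⇒≃ (λ n → ℚ.+-inverseʳ (seq (re z) n)) (λ n → ℚ.+-inverseʳ (seq (im z) n)))
  ; ⁻¹-cong = λ {z} {w} → -‿cong z w }

+-comm : ∀ z w → z + w ≃ w + z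
+-comm z w = ≡⇒≃
  (λ n → ℚ.+-comm (seq (re z) n) (seq (re w) n))
  (λ n → ℚ.+-comm (seq (im z) n) (seq (im w) n))

*-assoc : ∀ z w u → z * w * u ≃ z * (w * u)
*-assoc z w u = ≡⇒≃
  (λ n → solve 6 (λ a b c d e f →
      (a :* c :+ :- (b :* d)) :* e :+ :- ((a :* d :+ b :* c) :* f)
      := a :* (c :* e :+ :- (d :* f)) :+ :- (b :* (c :* f :+ d :* e))) refl
    (seq (re z) n) (seq (im z) n) (seq (re w) n) (seq (im w) n) (seq (re u) n) (seq (im u) n))
  (λ n → solve 6 (λ a b c d e f →
      (a :* c :+ :- (b :* d)) :* f :+ (a :* d :+ b :* c) :* e
      := a :* (c :* f :+ d :* e) :+ b :* (c :* e :+ :- (d :* f))) refl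
    (seq (re z) n) (seq (im z) n) (seq (re w) n) (seq (im w) n) (seq (re u) n) (seq (im u) n))

*-comm : ∀ z w → z * w ≃ w * z
*-comm z w = ≡⇒≃
  (λ n → solve 4 (λ a b c d → a :* c :+ :- (b :* d) := c :* a :+ :- (d :* b)) refl
    (seq (re z) n) (seq (im z) n) (seq (re w) n) (seq (im w) n))
  (λ n → solve 4 (λ a b c d → a :* d :+ b :* c := c :* b :+ d :* a) refl
    (seq (re z) n) (seq (im z) n) (seq (re w) n) (seq (im w) n))

*-identityˡ : ∀ z → 1ℂ * z ≃ z
*-identityˡ z = ≡⇒≃
  (λ n → solve 2 (λ a b → con 1ℚ :* a :+ :- (con 0ℚ :* b) := a) refl (seq (re z) n) (seq (im z) n))
  (λ n → solve 2 (λ a b → con 1ℚ :* b :+ con 0ℚ :* a := b) refl (seq (re z) n) (seq (im z) n))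

*-distribˡ-+ : ∀ z w u → z * (w + u) ≃ z * w + z * u
*-distribˡ-+ z w u = ≡⇒≃
  (λ n → solve 6 (λ a b c d e f →
      a :* (c :+ e) :+ :- (b :* (d :+ f)) := (a :* c :+ :- (b :* d)) :+ (a :* e :+ :- (b :* f))) refl
    (seq (re z) n) (seq (im z) n) (seq (re w) n) (seq (im w) n) (seq (re u) n) (seq (im u) n))
  (λ n → solve 6 (λ a b c d e f →
      a :* (d :+ f) :+ b :* (c :+ e) := (a :* d :+ b :* c) :+ (a :* f :+ b :* e)) refl
    (seq (re z) n) (seq (im z) n) (seq (re w) n) (seq (im w) n) (seq (re u) n) (seq (im u) n))

*-distribʳ-+ : ∀ u z w → (z + w) * u ≃ z * u + w * u
*-distribʳ-+ u z w = ≃-trans (*-comm (z + w) u) (≃-trans (*-distribˡ-+ u z w)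
  (+-cong (u * z) (z * u) (u * w) (w * u) (*-comm u z) (*-comm u w)))

+-*-isCommutativeRing : IsCommutativeRing _≃_ _+_ _*_ (-_) 0ℂ 1ℂ
+-*-isCommutativeRing = record
  { isRing = record
    { +-isAbelianGroup = record { isGroup = +-0-isGroup ; comm = +-comm }
    ; *-cong = λ {z} {z′} {w} {w′} → *-cong z z′ w w′
    ; *-assoc = *-assoc
    ; *-identity = *-identityˡ , λ z → ≃-trans (*-comm z 1ℂ) (*-identityˡ z)
    ; distrib = *-distribˡ-+ , *-distribʳ-+ }
  ; *-comm = *-comm }

fromℝ-cong : ∀ x y → x Real.≈ y → fromℝ x ≃ fromℝ y
fromℝ-cong x y x≈y = ⟪ x≈y , Reals.≡⇒≈ 0ℝ 0ℝ (λ _ → refl) ⟫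

-- Here `w` is the conjugate of `z` scaled by `ρ`, which stands for the reciprocal of `normSq z`.
-- The imaginary part of the product cancels at every index; the real part is `ρ` times `normSq z`,
-- which is 1 only from some index on.
conjugate-inverse : ∀ z w (ρ : ℕ → ℚ) →
  (∀ n → seq (re w) n ≡ seq (re z) n ℚ.* ρ n) → (∀ n → seq (im w) n ≡ ℚ.- seq (im z) n ℚ.* ρ n) →
  Eventually (λ n → ρ n ℚ.* seq (normSq z) n ≡ 1ℚ) → w * z ≃ 1ℂ
conjugate-inverse z w ρ re-w im-w inverse = ⟪
  Reals.ev-≡⇒≈ (re (w * z)) 1ℝ (map-ev (λ n eq → trans
    (cong₂ (λ c d → c ℚ.* seq (re z) n ℚ.+ ℚ.- (d ℚ.* seq (im z) n)) (re-w n) (im-w n))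
    (trans (solve 3 (λ a b r → a :* r :* a :+ :- (:- b :* r :* b) := r :* (a :* a :+ b :* b)) refl
      (seq (re z) n) (seq (im z) n) (ρ n)) eq)) inverse) ,
  Reals.≡⇒≈ (im (w * z)) 0ℝ (λ n → trans
    (cong₂ (λ c d → c ℚ.* seq (im z) n ℚ.+ d ℚ.* seq (re z) n) (re-w n) (im-w n))
    (solve 3 (λ a b r → a :* r :* b :+ :- b :* r :* a := con 0ℚ) refl
      (seq (re z) n) (seq (im z) n) (ρ n))) ⟫

inv-inverseˡ : ∀ z (z#0 : z # 0ℂ) → inv z z#0 * z ≃ 1ℂ
inv-inverseˡ z z#0 = conjugate-inverse z (inv z z#0) (λ n → recip (seq (normSq z) n))
  (λ _ → refl) (λ _ → refl) (Reals.recip-inverse (normSq z) (inj₂ (normSq-pos z z#0)))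

module Inverse (w : ℂ) (w#0 : w # 0ℂ) =
  InverseIdentities _≃_ _+_ _*_ (-_) 0ℂ 1ℂ +-*-isCommutativeRing w (inv w w#0) (inv-inverseˡ w w#0)

-- Case distinctions on complex apartness

¬#⇒≃ : ∀ {z w} → ¬ (z # w) → z ≃ w
¬#⇒≃ {z} {w} ¬# = ⟪ Reals.¬#⇒≈ (re z) (re w) (¬# ∘ inj₁) , Reals.¬#⇒≈ (im z) (im w) (¬# ∘ inj₂) ⟫

≃⇒¬# : ∀ {z w} → z ≃ w → ¬ (z # w)
≃⇒¬# {z} {w} ⟪ p , q ⟫ (inj₁ re#) = Reals.≈⇒¬# (re z) (re w) p re#
≃⇒¬# {z} {w} ⟪ p , q ⟫ (inj₂ im#) = Reals.≈⇒¬# (im z) (im w) q im#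

≃-stable : ∀ {z w} → ¬ ¬ (z ≃ w) → z ≃ w
≃-stable ¬¬≃ = ¬#⇒≃ λ z#w → ¬¬≃ λ z≃w → ≃⇒¬# z≃w z#w

-- If the goal failed, the first branch would refute apartness; then tightness gives `z ≃ w`, and
-- the second branch proves the goal after all.
#-cases : ∀ {z w u v} → (z # w → u ≃ v) → (z ≃ w → u ≃ v) → u ≃ v
#-cases if-# if-≃ = ≃-stable λ ¬goal → ¬goal (if-≃ (¬#⇒≃ (¬goal ∘ if-#)))

-- Rational bounds on the components of complex numbers

infix 4 _≲_

record _≲_ (z : ℂ) (e : ℚ) : Set where
  constructor bounds
  field
    re-bound : Eventually (λ n → ℚ.∣ seq (re z) n ∣ ℚ.≤ e)
    im-bound : Eventually (λ n → ℚ.∣ seq (im z) n ∣ ℚ.≤ e)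

≲-weaken : ∀ {z d e} → d ℚ.≤ e → z ≲ d → z ≲ e
≲-weaken d≤e (bounds p q) =
  bounds (map-ev (λ _ h → ℚ.≤-trans h d≤e) p) (map-ev (λ _ h → ℚ.≤-trans h d≤e) q)

-- As `o` is a variable, `fromℝ 0ℝ` and `0ℂ` are compared on their own, through the argument `refl`,
-- and not inside the difference.
≲-minus-0 : ∀ z o {e} → o ≡ 0ℂ → z ≲ e → z - o ≲ e
≲-minus-0 z .0ℂ {e} refl (bounds p q) = bounds
  (map-ev (λ n → subst (λ a → ℚ.∣ a ∣ ℚ.≤ e) (sym (ℚ.+-identityʳ (seq (re z) n)))) p)
  (map-ev (λ n → subst (λ a → ℚ.∣ a ∣ ℚ.≤ e) (sym (ℚ.+-identityʳ (seq (im z) n)))) q)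

≲-* : ∀ z w {d e} → z ≲ d → w ≲ e → z * w ≲ d ℚ.* e ℚ.+ d ℚ.* e
≲-* z w {d} {e} (bounds p q) (bounds p′ q′) = bounds
  (zip-ev (λ n h k → Reals.+-estimate (a n ℚ.* c n) (ℚ.- (b n ℚ.* d′ n)) h
      (subst (ℚ._≤ d ℚ.* e) (sym (ℚ.∣-p∣≡∣p∣ (b n ℚ.* d′ n))) k))
    (zip-ev (λ n → mul (a n) (c n)) p p′) (zip-ev (λ n → mul (b n) (d′ n)) q q′))
  (zip-ev (λ n → Reals.+-estimate (a n ℚ.* d′ n) (b n ℚ.* c n))
    (zip-ev (λ n → mul (a n) (d′ n)) p q′) (zip-ev (λ n → mul (b n) (c n)) q p′))
  where
  a b c d′ : ℕ → ℚ
  a = seq (re z)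
  b = seq (im z)
  c = seq (re w)
  d′ = seq (im w)
  mul : ∀ u v → ℚ.∣ u ∣ ℚ.≤ d → ℚ.∣ v ∣ ℚ.≤ e → ℚ.∣ u ℚ.* v ∣ ℚ.≤ d ℚ.* e
  mul u v u≤ v≤ = subst (ℚ._≤ d ℚ.* e) (sym (ℚ.∣p*q∣≡∣p∣*∣q∣ u v))
    (*-mono (ℚ.0≤∣p∣ u) (ℚ.≤-trans (ℚ.0≤∣p∣ v) v≤) u≤ v≤)

≲-minusˡ : ∀ z w {d e} → z - w ≲ e → w ≲ d → z ≲ d ℚ.+ e
≲-minusˡ z w {d} {e} (bounds p q) (bounds p′ q′) = bounds
  (zip-ev (λ n → step (seq (re z) n) (seq (re w) n)) p′ p)
  (zip-ev (λ n → step (seq (im z) n) (seq (im w) n)) q′ q)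
  where
  step : ∀ a b → ℚ.∣ b ∣ ℚ.≤ d → ℚ.∣ a ℚ.+ ℚ.- b ∣ ℚ.≤ e → ℚ.∣ a ∣ ℚ.≤ d ℚ.+ e
  step a b b≤ a-b≤ = subst (λ c → ℚ.∣ c ∣ ℚ.≤ d ℚ.+ e)
    (solve 2 (λ a b → b :+ (a :+ :- b) := a) refl a b)
    (Reals.+-estimate b (a ℚ.+ ℚ.- b) b≤ a-b≤)

≲-minusʳ : ∀ z w {d e} → z - w ≲ e → z ≲ d → w ≲ d ℚ.+ e
≲-minusʳ z w {d} {e} (bounds p q) (bounds p′ q′) = bounds
  (zip-ev (λ n → step (seq (re z) n) (seq (re w) n)) p′ p)
  (zip-ev (λ n → step (seq (im z) n) (seq (im w) n)) q′ q)
  where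
  step : ∀ a b → ℚ.∣ a ∣ ℚ.≤ d → ℚ.∣ a ℚ.+ ℚ.- b ∣ ℚ.≤ e → ℚ.∣ b ∣ ℚ.≤ d ℚ.+ e
  step a b a≤ a-b≤ = subst (λ c → ℚ.∣ c ∣ ℚ.≤ d ℚ.+ e)
    (solve 2 (λ a b → a :+ :- (a :+ :- b) := b) refl a b)
    (Reals.+-estimate a (ℚ.- (a ℚ.+ ℚ.- b)) a≤
      (subst (ℚ._≤ e) (sym (ℚ.∣-p∣≡∣p∣ (a ℚ.+ ℚ.- b))) a-b≤))

-- A bound concerns the terms of one representative. An equal number may have slightly larger terms
-- at every index, hence the slack `e`.
≲-resp : ∀ {z w d e} → z ≃ w → 0ℚ ℚ.< e → z ≲ d → w ≲ d ℚ.+ e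
≲-resp {z} {w} {d} {e} ⟪ p , q ⟫ 0<e = ≲-minusʳ z w (bounds (p e 0<e) (q e 0<e))

≲-null : ∀ z → (∀ ε → 0ℚ ℚ.< ε → z ≲ ε) → z ≃ 0ℂ
≲-null z h = ⟪ (λ ε 0<ε → _≲_.re-bound (≲-minus-0 z 0ℂ refl (h ε 0<ε)))
           , (λ ε 0<ε → _≲_.im-bound (≲-minus-0 z 0ℂ refl (h ε 0<ε))) ⟫

bounded : ∀ z → ∃[ B ] 0ℚ ℚ.< B × z ≲ B
bounded z = combine (Real.bound (re z)) (Real.bound (im z))
  where
  combine : ∃[ B ] 0ℚ ℚ.< B × Eventually (λ n → ℚ.∣ seq (re z) n ∣ ℚ.≤ B) →
            ∃[ C ] 0ℚ ℚ.< C × Eventually (λ n → ℚ.∣ seq (im z) n ∣ ℚ.≤ C) →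
            ∃[ B ] 0ℚ ℚ.< B × z ≲ B
  combine (B , 0<B , p) (C , 0<C , q) = B ℚ.+ C , sum-pos 0<B 0<C , bounds
    (map-ev (λ n h → ℚ.≤-trans h B≤) p) (map-ev (λ n h → ℚ.≤-trans h C≤) q)
    where
    B≤ : B ℚ.≤ B ℚ.+ C
    B≤ = subst (ℚ._≤ B ℚ.+ C) (ℚ.+-identityʳ B) (ℚ.+-monoʳ-≤ B (ℚ.<⇒≤ 0<C))
    C≤ : C ℚ.≤ B ℚ.+ C
    C≤ = subst (ℚ._≤ B ℚ.+ C) (ℚ.+-identityˡ C) (ℚ.+-monoˡ-≤ C (ℚ.<⇒≤ 0<B))

#0⇒¬≲ : ∀ {z} → z # 0ℂ → ∃[ δ ] 0ℚ ℚ.< δ × ¬ (z ≲ δ)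
#0⇒¬≲ {z} z#0 = witness z#0
  where
  contra : ∀ {δ} → 0ℚ ℚ.< δ → ∀ {x : ℕ → ℚ} → Eventually (λ n → δ ℚ.≤ ℚ.∣ x n ∣) →
           ¬ Eventually (λ n → ℚ.∣ x n ∣ ℚ.≤ ½ ℚ.* δ)
  contra {δ} 0<δ lower upper = pos≰0 (half-pos 0<δ) (ev-const (zip-ev
    (λ n p q → ≤-by (ℚ.≤-trans p q)
      (solve 1 (λ d → con ½ :* d :- d := con 0ℚ :- con ½ :* d) refl δ))
    lower upper))
  witness : z # 0ℂ → ∃[ δ ] 0ℚ ℚ.< δ × ¬ (z ≲ δ)
  witness (inj₁ x#0) with Real.separated {re z} x#0
  ... | δ , 0<δ , lower = ½ ℚ.* δ , half-pos 0<δ , contra 0<δ lower ∘ _≲_.re-bound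
  witness (inj₂ y#0) with Real.separated {im z} y#0
  ... | δ , 0<δ , lower = ½ ℚ.* δ , half-pos 0<δ , contra 0<δ lower ∘ _≲_.im-bound

#0⊎≲ : ∀ z e → 0ℚ ℚ.< e → z # 0ℂ ⊎ z ≲ e
#0⊎≲ z e 0<e with Reals.#⊎close (re z) 0ℝ e 0<e | Reals.#⊎close (im z) 0ℝ e 0<e
... | inj₁ x#0 | _        = inj₁ (inj₁ x#0)
... | inj₂ _   | inj₁ y#0 = inj₁ (inj₂ y#0)
... | inj₂ p   | inj₂ q   = inj₂ (bounds
  (map-ev (λ n → subst (λ a → ℚ.∣ a ∣ ℚ.≤ e) (ℚ.+-identityʳ (seq (re z) n))) p)
  (map-ev (λ n → subst (λ a → ℚ.∣ a ∣ ℚ.≤ e) (ℚ.+-identityʳ (seq (im z) n))) q))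

-- Choose d so small that `u ≲ d` would make the product w u too small for `z`, which keeps a
-- positive distance from 0. Since `#0⊎≲` decides between apartness and `u ≲ d`, only apartness
-- remains.
factor-#0 : ∀ z w u → w * u ≃ z → z # 0ℂ → u # 0ℂ
factor-#0 z w u wu≃z z#0 = search (#0⇒¬≲ z#0) (bounded w)
  where
  search : ∃[ δ ] 0ℚ ℚ.< δ × ¬ (z ≲ δ) → ∃[ B ] 0ℚ ℚ.< B × w ≲ B → u # 0ℂ
  search (δ , 0<δ , z≴δ) (B , 0<B , w≲B) = conclude (#0⊎≲ u d (proj₁ (proj₂ small)))
    where
    small : ∃[ d ] 0ℚ ℚ.< d × d ℚ.≤ 1ℚ × d ℚ.* (B ℚ.+ B) ℚ.≤ ½ ℚ.* δ
    small = shrink 0<1 (half-pos 0<δ) (sum-pos 0<B 0<B)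

    d : ℚ
    d = proj₁ small

    product≤ : B ℚ.* d ℚ.+ B ℚ.* d ℚ.≤ ½ ℚ.* δ
    product≤ = subst (ℚ._≤ ½ ℚ.* δ)
      (solve 2 (λ d b → d :* (b :+ b) := b :* d :+ b :* d) refl d B)
      (proj₂ (proj₂ (proj₂ small)))

    conclude : u # 0ℂ ⊎ u ≲ d → u # 0ℂ
    conclude (inj₁ u#0) = u#0
    conclude (inj₂ u≲d) = contradiction
      (subst (z ≲_) (halves δ) (≲-resp {d = ½ ℚ.* δ} {e = ½ ℚ.* δ} wu≃z (half-pos 0<δ)
        (≲-weaken product≤ (≲-* w u w≲B u≲d))))
      z≴δ

-- Rational bounds versus the modulus

∣∣-isRoot : ∀ z n → IsRoot (seq (normSq z) n) (mesh n) (seq ∣ z ∣ n)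
∣∣-isRoot z n = proj₂ (root (normSq-nonNeg z n) (mesh-pos n))

square-reflects : ∀ {p q} → 0ℚ ℚ.< q → p ℚ.* p ℚ.< q ℚ.* q → p ℚ.≤ q
square-reflects {p} {q} 0<q p²<q² = ℚ.≮⇒≥ λ q<p → ℚ.<-irrefl refl (ℚ.<-≤-trans p²<q²
  (*-mono (ℚ.<⇒≤ 0<q) (ℚ.≤-trans (ℚ.<⇒≤ 0<q) (ℚ.<⇒≤ q<p)) (ℚ.<⇒≤ q<p) (ℚ.<⇒≤ q<p)))

-- A term of the modulus falls short of the true root by less than `mesh n`. The margin η of the
-- strict inequality eventually absorbs this defect.
∣∣<⇒≲ : ∀ z {e} → 0ℚ ℚ.< e → ∣ z ∣ Real.< Real.fromℚ e → z ≲ e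
∣∣<⇒≲ z {e} 0<e (η , 0<η , s+η≤e) = bounds
  (map-ev (λ n lt → component (seq (re z) n) (seq (im z) n) lt) normSq<)
  (map-ev (λ n lt → component (seq (im z) n) (seq (re z) n)
    (subst (ℚ._< e ℚ.* e) (ℚ.+-comm (seq (re z) n ℚ.* seq (re z) n) (seq (im z) n ℚ.* seq (im z) n)) lt)) normSq<)
  where
  normSq< : Eventually (λ n → seq (normSq z) n ℚ.< e ℚ.* e)
  normSq< = zip-ev (λ n s+η≤e mesh≤η → case n s+η≤e mesh≤η (∣∣-isRoot z n)) s+η≤e (mesh-small 0<η)
    where
    case : ∀ n → seq ∣ z ∣ n ℚ.+ η ℚ.≤ e → mesh n ℚ.≤ η →
           IsRoot (seq (normSq z) n) (mesh n) (seq ∣ z ∣ n) → seq (normSq z) n ℚ.< e ℚ.* e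
    case n s+η≤e mesh≤η (0≤s , _ , q<) = ℚ.<-≤-trans q<
      (*-mono 0≤s+m (ℚ.<⇒≤ 0<e) s+m≤e s+m≤e)
      where
      s+m≤e = ℚ.≤-trans (ℚ.+-monoʳ-≤ (seq ∣ z ∣ n) mesh≤η) s+η≤e
      0≤s+m = ℚ.+-mono-≤ 0≤s (ℚ.<⇒≤ (mesh-pos n))
  component : ∀ a b → a ℚ.* a ℚ.+ b ℚ.* b ℚ.< e ℚ.* e → ℚ.∣ a ∣ ℚ.≤ e
  component a b lt = square-reflects 0<e (ℚ.≤-<-trans
    (≤-by (0≤p² b) (trans (solve 2 (λ a b → b :* b :- con 0ℚ := (a :* a :+ b :* b) :- a :* a) refl a b)
      (cong (λ u → (a ℚ.* a ℚ.+ b ℚ.* b) ℚ.- u) (sym (∣p∣²≡p² a))))) lt)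

-- The terms of the modulus are at most √2 e, coarsened to 2e to stay rational; the third e is the
-- margin that a strict inequality of reals asks for.
≲⇒∣∣< : ∀ z δ {e} → 0ℚ ℚ.< e → z ≲ e → Eventually (λ n → e ℚ.+ e ℚ.+ e ℚ.≤ seq δ n) →
        ∣ z ∣ Real.< δ
≲⇒∣∣< z δ {e} 0<e (bounds p q) 3e≤δ = e , 0<e ,
  zip-ev (λ n (a≤ , b≤) → ℚ.≤-trans (ℚ.+-monoˡ-≤ e (root≤ n a≤ b≤ (∣∣-isRoot z n))))
    (zip-ev (λ _ → _,_) p q) 3e≤δ
  where
  square≤ : ∀ a → ℚ.∣ a ∣ ℚ.≤ e → a ℚ.* a ℚ.≤ e ℚ.* e
  square≤ a a≤ = subst (ℚ._≤ e ℚ.* e) (∣p∣²≡p² a) (*-mono (ℚ.0≤∣p∣ a) (ℚ.<⇒≤ 0<e) a≤ a≤)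
  2e²<4e² : e ℚ.* e ℚ.+ e ℚ.* e ℚ.< (e ℚ.+ e) ℚ.* (e ℚ.+ e)
  2e²<4e² = subst₂ ℚ._<_ (ℚ.+-identityʳ _)
    (solve 1 (λ e → (e :* e :+ e :* e) :+ (e :* e :+ e :* e) := (e :+ e) :* (e :+ e)) refl e)
    (ℚ.+-monoʳ-< (e ℚ.* e ℚ.+ e ℚ.* e) (sum-pos (*-pos 0<e 0<e) (*-pos 0<e 0<e)))
  root≤ : ∀ n → ℚ.∣ seq (re z) n ∣ ℚ.≤ e → ℚ.∣ seq (im z) n ∣ ℚ.≤ e →
          IsRoot (seq (normSq z) n) (mesh n) (seq ∣ z ∣ n) → seq ∣ z ∣ n ℚ.≤ e ℚ.+ e
  root≤ n a≤ b≤ (_ , s²≤ , _) = square-reflects (sum-pos 0<e 0<e)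
    (ℚ.≤-<-trans s²≤ (ℚ.≤-<-trans
      (ℚ.+-mono-≤ (square≤ (seq (re z) n) a≤) (square≤ (seq (im z) n) b≤)) 2e²<4e²))

fromℚ-≲ : ∀ {t d} → ℚ.∣ t ∣ ℚ.≤ d → fromℝ (Real.fromℚ t) ≲ d
fromℚ-≲ {t} ∣t∣≤d = bounds (0 , λ _ _ → ∣t∣≤d) (0 , λ _ _ → ℚ.≤-trans (ℚ.0≤∣p∣ t) ∣t∣≤d)

thirds : ∀ δ → 0ℝ Real.< δ → ∃[ e ] 0ℚ ℚ.< e × Eventually (λ n → e ℚ.+ e ℚ.+ e ℚ.≤ seq δ n)
thirds δ (η , 0<η , N , η≤δ) = third ℚ.* η , *-pos (ℚ.positive⁻¹ third) 0<η , N ,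
  λ n n≥ → subst (ℚ._≤ seq δ n)
    (solve 1 (λ η → con 0ℚ :+ η := con third :* η :+ con third :* η :+ con third :* η) refl η)
    (η≤δ n n≥)
  where
  third : ℚ
  third = + 1 ℚ./ 3

fromℚ-pos : ∀ {q} → 0ℚ ℚ.< q → 0ℝ Real.< Real.fromℚ q
fromℚ-pos {q} 0<q = q , 0<q , 0 , λ _ _ → ℚ.≤-reflexive (ℚ.+-identityˡ q)

fromℚ-neg : ∀ {q} → 0ℚ ℚ.< q → Real.fromℚ (ℚ.- q) Real.< 0ℝ
fromℚ-neg {q} 0<q = q , 0<q , 0 , λ _ _ → ℚ.≤-reflexive (ℚ.+-inverseˡ q)

-- Limits and continuity in terms of rational bounds

value-≃ : ∀ {f} → Extensional f → ∀ {z w} → z ≃ w →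
          (p : Dom f z) (q : Dom f w) → value f z p ≃ value f w q
value-≃ ext z≃w p q = ⟪ Extensional.value-cong ext (≈-of z≃w) p q ⟫

-- Tolerance 1 in the definition of the limit gives the bound. Boundedness is enough, because the
-- difference quotient will be multiplied by a factor tending to 0.
limit⇒bounded : ∀ g v → IsLimit g 0ℂ v → ∃[ B ] 0ℚ ℚ.< B × ∃[ δ ] 0ℚ ℚ.< δ ×
                (∀ z (p : Dom g z) → z # 0ℂ → z ≲ δ → value g z p ≲ B)
limit⇒bounded g v (_ , near) = combine (bounded v) (near 1ℝ (fromℚ-pos 0<1))
  where
  combine : ∃[ B ] 0ℚ ℚ.< B × v ≲ B →
            ∃[ δ ] 0ℝ Real.< δ × (∀ z (p : Dom g z) → z # 0ℂ → ∣ z - 0ℂ ∣ Real.< δ → ∣ value g z p - v ∣ Real.< 1ℝ) →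
            ∃[ B ] 0ℚ ℚ.< B × ∃[ δ ] 0ℚ ℚ.< δ × (∀ z (p : Dom g z) → z # 0ℂ → z ≲ δ → value g z p ≲ B)
  combine (B , 0<B , v≲B) (δ , 0<δ , close) = B ℚ.+ 1ℚ , sum-pos 0<B 0<1 , e , 0<e ,
    λ z p z#0 z≲e → ≲-minusˡ (value g z p) v
      (∣∣<⇒≲ (value g z p - v) 0<1
        (close z p z#0 (≲⇒∣∣< (z - 0ℂ) δ 0<e (≲-minus-0 z 0ℂ refl z≲e) (proj₂ (proj₂ (thirds δ 0<δ))))))
      v≲B
    where
    e : ℚ
    e = proj₁ (thirds δ 0<δ)
    0<e : 0ℚ ℚ.< e
    0<e = proj₁ (proj₂ (thirds δ 0<δ))

continuous⇒close : ∀ f α β → ContinuousAt f α β 0ℝ → (q : Dom f (fromℝ 0ℝ)) → ∀ ε → 0ℚ ℚ.< ε →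
  ∃[ δ ] 0ℚ ℚ.< δ × (∀ t → Real.fromℚ t ∈[ α , β ] → (p : Dom f (fromℝ (Real.fromℚ t))) →
    ℚ.∣ t ∣ ℚ.≤ δ → value f (fromℝ (Real.fromℚ t)) p - value f (fromℝ 0ℝ) q ≲ ε)
continuous⇒close f α β cont q ε 0<ε = combine (cont q (Real.fromℚ ε) (fromℚ-pos 0<ε))
  where
  combine : ∃[ δ ] 0ℝ Real.< δ ×
      (∀ x → x ∈[ α , β ] → (p : Dom f (fromℝ x)) → ∣ fromℝ x - fromℝ 0ℝ ∣ Real.< δ →
        ∣ value f (fromℝ x) p - value f (fromℝ 0ℝ) q ∣ Real.< Real.fromℚ ε) →
    ∃[ δ ] 0ℚ ℚ.< δ × (∀ t → Real.fromℚ t ∈[ α , β ] → (p : Dom f (fromℝ (Real.fromℚ t))) →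
      ℚ.∣ t ∣ ℚ.≤ δ → value f (fromℝ (Real.fromℚ t)) p - value f (fromℝ 0ℝ) q ≲ ε)
  combine (δ , 0<δ , close) = e , 0<e , λ t t∈ p ∣t∣≤e →
    ∣∣<⇒≲ (value f (fromℝ (Real.fromℚ t)) p - value f (fromℝ 0ℝ) q) 0<ε
      (close (Real.fromℚ t) t∈ p
        (≲⇒∣∣< (fromℝ (Real.fromℚ t) - fromℝ 0ℝ) δ 0<e
          (≲-minus-0 (fromℝ (Real.fromℚ t)) (fromℝ 0ℝ) refl (fromℚ-≲ ∣t∣≤e)) (proj₂ (proj₂ (thirds δ 0<δ)))))
    where
    e : ℚ
    e = proj₁ (thirds δ 0<δ)
    0<e : 0ℚ ℚ.< e
    0<e = proj₁ (proj₂ (thirds δ 0<δ))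
minus-≃0 : ∀ z w → z ≃ w → z + - w ≃ 0ℂ
minus-≃0 z w z≃w = ≃-trans
  (+-cong z w (- w) (- w) z≃w ≃-refl) (proj₂ (IsGroup.inverse +-0-isGroup) w)

*-≃0 : ∀ {z} w → z ≃ 0ℂ → z * w ≃ 0ℂ
*-≃0 {z} w z≃0 = ≃-trans (*-cong z 0ℂ w w z≃0 ≃-refl) (IsCommutativeRing.zeroˡ +-*-isCommutativeRing w)

-- Rational points of an interval near an endpoint equal to 0

Accumulates : ℝ → ℝ → Set
Accumulates α β = ∀ d → 0ℚ ℚ.< d →
  ∃[ t ] Real.fromℚ t Real.# 0ℝ × ℚ.∣ t ∣ ℚ.≤ d × Real.fromℚ t ∈[ α , β ]

module Endpoints (α β : ℝ) (α<β : α Real.< β) where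

  private
    η : ℚ
    η = proj₁ α<β
    0<η : 0ℚ ℚ.< η
    0<η = proj₁ (proj₂ α<β)
    α+η≤β : Eventually (λ n → seq α n ℚ.+ η ℚ.≤ seq β n)
    α+η≤β = proj₂ (proj₂ α<β)

    -- The endpoint that equals 0 may have nonzero terms. Half of the margin η between the endpoints
    -- pays for their size, and the other half leaves room for `t`.
    step : ∀ d → 0ℚ ℚ.< d → ∃[ t ] 0ℚ ℚ.< t × t ℚ.≤ d × t ℚ.* 1ℚ ℚ.≤ ½ ℚ.* η
    step d 0<d = shrink 0<d (half-pos 0<η) 0<1

    ∣t∣≤ : ∀ {t d} → 0ℚ ℚ.< t → t ℚ.≤ d → ℚ.∣ t ∣ ℚ.≤ d
    ∣t∣≤ {t} {d} 0<t = subst (ℚ._≤ d) (sym (ℚ.0≤p⇒∣p∣≡p (ℚ.<⇒≤ 0<t)))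

  accumulates-left : α Real.≈ 0ℝ → Accumulates α β
  accumulates-left α≈0 d 0<d = choose (step d 0<d)
    where
    choose : ∃[ t ] 0ℚ ℚ.< t × t ℚ.≤ d × t ℚ.* 1ℚ ℚ.≤ ½ ℚ.* η →
             ∃[ t ] Real.fromℚ t Real.# 0ℝ × ℚ.∣ t ∣ ℚ.≤ d × Real.fromℚ t ∈[ α , β ]
    choose (t , 0<t , t≤d , t≤½η) = t , inj₂ (fromℚ-pos {t} 0<t) , ∣t∣≤ 0<t t≤d ,
      Reals.ev-≤⇒≤ α (Real.fromℚ t) (map-ev (λ n → lower (seq α n)) (α≈0 t 0<t)) ,
      Reals.ev-≤⇒≤ (Real.fromℚ t) β (zip-ev (λ n → upper (seq α n) (seq β n))
        (α≈0 (½ ℚ.* η) (half-pos 0<η)) α+η≤β)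
      where
      lower : ∀ a → ℚ.∣ a ℚ.- 0ℚ ∣ ℚ.≤ t → a ℚ.≤ t
      lower a a≤ = ≤-by (ℚ.≤-trans (p≤∣p∣ (a ℚ.- 0ℚ)) a≤)
        (solve 2 (λ a t → t :- (a :- con 0ℚ) := t :- a) refl a t)
      upper : ∀ a b → ℚ.∣ a ℚ.- 0ℚ ∣ ℚ.≤ ½ ℚ.* η → a ℚ.+ η ℚ.≤ b → t ℚ.≤ b
      upper a b a≤ a+η≤b = ≤-by
        (ℚ.+-mono-≤ (ℚ.+-mono-≤ (ℚ.≤-trans (-p≤∣p∣ (a ℚ.- 0ℚ)) a≤) a+η≤b) t≤½η)
        (solve 4 (λ a b t η →
            ((con ½ :* η :+ b) :+ con ½ :* η) :- ((:- (a :- con 0ℚ) :+ (a :+ η)) :+ t :* con 1ℚ)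
            := b :- t) refl a b t η)

  accumulates-right : β Real.≈ 0ℝ → Accumulates α β
  accumulates-right β≈0 d 0<d = choose (step d 0<d)
    where
    choose : ∃[ t ] 0ℚ ℚ.< t × t ℚ.≤ d × t ℚ.* 1ℚ ℚ.≤ ½ ℚ.* η →
             ∃[ t ] Real.fromℚ t Real.# 0ℝ × ℚ.∣ t ∣ ℚ.≤ d × Real.fromℚ t ∈[ α , β ]
    choose (t , 0<t , t≤d , t≤½η) = ℚ.- t , inj₁ (fromℚ-neg {t} 0<t) ,
      subst (ℚ._≤ d) (sym (ℚ.∣-p∣≡∣p∣ t)) (∣t∣≤ 0<t t≤d) ,
      Reals.ev-≤⇒≤ α (Real.fromℚ (ℚ.- t)) (zip-ev (λ n → lower (seq α n) (seq β n))
        (β≈0 (½ ℚ.* η) (half-pos 0<η)) α+η≤β) ,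
      Reals.ev-≤⇒≤ (Real.fromℚ (ℚ.- t)) β (map-ev (λ n → upper (seq β n)) (β≈0 t 0<t))
      where
      upper : ∀ b → ℚ.∣ b ℚ.- 0ℚ ∣ ℚ.≤ t → ℚ.- t ℚ.≤ b
      upper b b≤ = ≤-by (ℚ.≤-trans (-p≤∣p∣ (b ℚ.- 0ℚ)) b≤)
        (solve 2 (λ b t → t :- :- (b :- con 0ℚ) := b :- :- t) refl b t)
      lower : ∀ a b → ℚ.∣ b ℚ.- 0ℚ ∣ ℚ.≤ ½ ℚ.* η → a ℚ.+ η ℚ.≤ b → a ℚ.≤ ℚ.- t
      lower a b b≤ a+η≤b = ≤-by
        (ℚ.+-mono-≤ (ℚ.+-mono-≤ (ℚ.≤-trans (p≤∣p∣ (b ℚ.- 0ℚ)) b≤) a+η≤b) t≤½η)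
        (solve 4 (λ a b t η →
            ((con ½ :* η :+ b) :+ con ½ :* η) :- (((b :- con 0ℚ) :+ (a :+ η)) :+ t :* con 1ℚ)
            := :- t :- a) refl a b t η)

-- Division by λ, the difference quotient, and the value of f at 0

module LambdaCalculusProperties (l : ℂ) (l#0 : l # 0ℂ) where

  open LambdaCalculus

  l*/λ : ∀ z → l * _/λ l l#0 z ≃ z
  l*/λ z = unfolded (_/λ l l#0 z) refl
    where
    -- Generalising over w restricts conversion to comparing z / λ with its
    -- one-step unfolding, outside the product.
    unfolded : ∀ w → z * inv l l#0 ≡ w → l * w ≃ z
    unfolded w refl = Inverse.cancel-inside l l#0 z

  l*-/λ : ∀ z → _/λ l l#0 (l * z) ≃ z
  l*-/λ z = unfolded (_/λ l l#0 (l * z)) refl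
    where
    unfolded : ∀ w → (l * z) * inv l l#0 ≡ w → w ≃ z
    unfolded w refl = Inverse.cancel-outside l l#0 z

  /λ-cong : ∀ z w → z ≃ w → _/λ l l#0 z ≃ _/λ l l#0 w
  /λ-cong z w z≃w = *-cong z w (inv l l#0) (inv l l#0) z≃w ≃-refl

  /λ-#0 : ∀ z → z # 0ℂ → _/λ l l#0 z # 0ℂ
  /λ-#0 z = factor-#0 z l (_/λ l l#0 z) (l*/λ z)

  *-quotient : ∀ f z (z#0 : z # 0ℂ) (p : Dom f (l * z)) →
               z * value (quotient l l#0 f) z (z#0 , p) ≃ value f (l * z) p
  *-quotient f z z#0 p = unfolded (value (quotient l l#0 f) z (z#0 , p)) refl
    where
    unfolded : ∀ w → value f (l * z) p * inv z z#0 ≡ w → z * w ≃ value f (l * z) p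
    unfolded w refl = Inverse.cancel-inside z z#0 (value f (l * z) p)

  module AtZero (f : PartialMap) (ext : Extensional f) (α β : ℝ) (defined : DefinedOn f α β)
                (accumulates : Accumulates α β) (continuous : ContinuousAt f α β 0ℝ)
                (v : ℂ) (limit : IsLimit (quotient l l#0 f) 0ℂ v) where

    SmallWithin : ℚ → ℚ → Set
    SmallWithin d e = ∀ t → Real.fromℚ t Real.# 0ℝ → ℚ.∣ t ∣ ℚ.≤ d →
      (p : Dom f (fromℝ (Real.fromℚ t))) → value f (fromℝ (Real.fromℚ t)) p ≲ e

    -- f t = (t / λ) (f t / (t / λ)), where the second factor stays bounded as t → 0.
    small-values : ∀ e → 0ℚ ℚ.< e → ∃[ d ] 0ℚ ℚ.< d × SmallWithin d e
    small-values e 0<e = combine (limit⇒bounded (quotient l l#0 f) v limit) (bounded (inv l l#0))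
      where
      combine : ∃[ B ] 0ℚ ℚ.< B × ∃[ δ ] 0ℚ ℚ.< δ ×
          (∀ z (p : Dom (quotient l l#0 f) z) → z # 0ℂ → z ≲ δ → value (quotient l l#0 f) z p ≲ B) →
        ∃[ L ] 0ℚ ℚ.< L × inv l l#0 ≲ L →
        ∃[ d ] 0ℚ ℚ.< d × SmallWithin d e
      combine (B , 0<B , δ , 0<δ , quotient≲B) (L , 0<L , 1/λ≲L) =
        -- This radius is for t / λ. Half of `e` bounds the product with the quotient; the other
        -- half is the slack spent by `≲-resp` when f (λ (t / λ)) is replaced by f t.
        choose (shrink 0<δ (half-pos 0<e) (sum-pos 0<B 0<B))
        where
        choose : ∃[ c ] 0ℚ ℚ.< c × c ℚ.≤ δ × c ℚ.* (B ℚ.+ B) ℚ.≤ ½ ℚ.* e →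
                 ∃[ d ] 0ℚ ℚ.< d × SmallWithin d e
        -- This radius is for t itself: `L` bounds 1 / λ, so t / λ stays within c. The upper limit 1
        -- is arbitrary.
        choose (c , 0<c , c≤δ , c[B+B]≤) = choose′ (shrink 0<1 0<c (sum-pos 0<L 0<L))
          where
          choose′ : ∃[ d ] 0ℚ ℚ.< d × d ℚ.≤ 1ℚ × d ℚ.* (L ℚ.+ L) ℚ.≤ c →
                    ∃[ d ] 0ℚ ℚ.< d × SmallWithin d e
          choose′ (d , 0<d , _ , d[L+L]≤) = d , 0<d , small
            where
            product≤ : c ℚ.* B ℚ.+ c ℚ.* B ℚ.≤ ½ ℚ.* e
            product≤ = subst (ℚ._≤ ½ ℚ.* e) (ℚ.*-distribˡ-+ c B B) c[B+B]≤

            scaled≤ : d ℚ.* L ℚ.+ d ℚ.* L ℚ.≤ c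
            scaled≤ = subst (ℚ._≤ c) (ℚ.*-distribˡ-+ d L L) d[L+L]≤

            small : SmallWithin d e
            small t t#0 ∣t∣≤d p = near (_/λ l l#0 (fromℝ (Real.fromℚ t)))
              (l*/λ (fromℝ (Real.fromℚ t))) (/λ-#0 (fromℝ (Real.fromℚ t)) (inj₁ t#0))
              (≲-weaken scaled≤ (≲-* (fromℝ (Real.fromℚ t)) (inv l l#0) (fromℚ-≲ ∣t∣≤d) 1/λ≲L))
              where
              near : ∀ τ → l * τ ≃ fromℝ (Real.fromℚ t) → τ # 0ℂ → τ ≲ c → value f (fromℝ (Real.fromℚ t)) p ≲ e
              near τ lτ≃t τ#0 τ≲c = conclude (Extensional.dom-resp ext (_≃_.≈-of (≃-sym lτ≃t)) p)
                where
                conclude : Dom f (l * τ) → value f (fromℝ (Real.fromℚ t)) p ≲ e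
                conclude q = ≲-weaken (ℚ.≤-reflexive (halves e))
                  (≲-resp (≃-trans (*-quotient f τ τ#0 q) (value-≃ ext lτ≃t q p)) (half-pos 0<e)
                    (≲-weaken product≤ (≲-* τ (value (quotient l l#0 f) τ (τ#0 , q)) τ≲c
                      (quotient≲B τ (τ#0 , q) τ#0 (≲-weaken c≤δ τ≲c)))))

    value-zero : (q : Dom f (fromℝ 0ℝ)) → value f (fromℝ 0ℝ) q ≃ 0ℂ
    value-zero q = ≲-null (value f (fromℝ 0ℝ) q) bound
      where
      CloseWithin : ℚ → ℚ → Set
      CloseWithin δ e = ∀ t → Real.fromℚ t ∈[ α , β ] → (p : Dom f (fromℝ (Real.fromℚ t))) →
        ℚ.∣ t ∣ ℚ.≤ δ → value f (fromℝ (Real.fromℚ t)) p - value f (fromℝ 0ℝ) q ≲ e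

      bound : ∀ ε → 0ℚ ℚ.< ε → value f (fromℝ 0ℝ) q ≲ ε
      bound ε 0<ε = combine (small-values (½ ℚ.* ε) (half-pos 0<ε))
                            (continuous⇒close f α β continuous q (½ ℚ.* ε) (half-pos 0<ε))
        where
        combine : ∃[ d ] 0ℚ ℚ.< d × SmallWithin d (½ ℚ.* ε) →
          ∃[ δ ] 0ℚ ℚ.< δ × CloseWithin δ (½ ℚ.* ε) → value f (fromℝ 0ℝ) q ≲ ε
        combine (d , 0<d , small) (δ , 0<δ , close) = choose (shrink 0<d 0<δ 0<1)
          where
          choose : ∃[ c ] 0ℚ ℚ.< c × c ℚ.≤ d × c ℚ.* 1ℚ ℚ.≤ δ → value f (fromℝ 0ℝ) q ≲ ε
          choose (c , 0<c , c≤d , c≤δ) = finish (accumulates c 0<c)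
            where
            finish : ∃[ t ] Real.fromℚ t Real.# 0ℝ × ℚ.∣ t ∣ ℚ.≤ c × Real.fromℚ t ∈[ α , β ] →
                     value f (fromℝ 0ℝ) q ≲ ε
            finish (t , t#0 , ∣t∣≤c , t∈) = ≲-weaken (ℚ.≤-reflexive (halves ε))
              (≲-minusʳ (value f (fromℝ (Real.fromℚ t)) p) (value f (fromℝ 0ℝ) q)
                (close t t∈ p (ℚ.≤-trans ∣t∣≤c (subst (ℚ._≤ δ) (ℚ.*-identityʳ c) c≤δ)))
                (small t t#0 (ℚ.≤-trans ∣t∣≤c c≤d) p))
              where
              p : Dom f (fromℝ (Real.fromℚ t))
              p = defined (Real.fromℚ t) t∈

  ≤-cases : ∀ α β {z w} → α Real.≤ β → (α Real.< β → z ≃ w) → (α Real.≈ β → z ≃ w) → z ≃ w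
  ≤-cases α β α≤β if-< if-≈ = ≃-stable λ ¬goal → ¬goal (if-≈ (Reals.¬#⇒≈ α β λ
    { (inj₁ α<β) → ¬goal (if-< α<β) ; (inj₂ β<α) → α≤β β<α }))

  -- The apartness proof enters only the proof that the reciprocals form a Cauchy sequence; the
  -- terms themselves agree.
  inv-irrelevant : ∀ z (p q : z # 0ℂ) → inv z p ≃ inv z q
  inv-irrelevant z p q = ≡⇒≃ (λ _ → refl) (λ _ → refl)

  =-elim : ∀ F z v → F [ z ]= v → (p : Dom F z) → value F z p ≃ v
  =-elim F z v (_ , eq) p = ⟪ eq p ⟫

  ∫-≃ : ∀ F a b A B (h : Integrable l l#0 F a b) →
        ∫₀ l l#0 F b (proj₂ h) ≃ B → ∫₀ l l#0 F a (proj₁ h) ≃ A → ∫ l l#0 F a b h ≃ B + - A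
  ∫-≃ F a b A B (p , q) b≃ a≃ = unfolded (∫ l l#0 F a b (p , q)) refl
    where
    unfolded : ∀ w → ∫₀ l l#0 F b q + - ∫₀ l l#0 F a p ≡ w → w ≃ B + - A
    unfolded w refl = +-cong (∫₀ l l#0 F b q) B (- ∫₀ l l#0 F a p) (- A) b≃
      (-‿cong (∫₀ l l#0 F a p) A a≃)

  -- The two parts of the theorem for an extensional function

  module _ (f : PartialMap) (ext : Extensional f) where

    -- The proof `z#0` belongs to the formula, while `z#0′` comes with an arbitrary element of the
    -- domain of the quotient, over all of which `_[_]=_` quantifies.
    quotient-∫ : ∀ a z (z#0 z#0′ : z # 0ℂ) (fz : Dom f z) (fa : Dom f (_/λ l l#0 a))
                 (h : Integrable l l#0 f a (l * z)) →
                 value (quotient l l#0 (integralFrom l l#0 f a)) z (z#0′ , h) ≃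
                 value f z fz + - (_/λ l l#0 a * value f (_/λ l l#0 a) fa * (1ℂ / z [ z#0 ]))
    quotient-∫ a z z#0 z#0′ fz fa h =
      unfolded (value (quotient l l#0 (integralFrom l l#0 f a)) z (z#0′ , h)) refl (1ℂ / z [ z#0 ]) refl
      where
      upper : ∫₀ l l#0 f (l * z) (proj₂ h) ≃ z * value f z fz
      upper = *-cong (_/λ l l#0 (l * z)) z (value f (_/λ l l#0 (l * z)) (proj₂ h)) (value f z fz)
        (l*-/λ z) (value-≃ ext (l*-/λ z) (proj₂ h) fz)

      lower : ∫₀ l l#0 f a (proj₁ h) ≃ _/λ l l#0 a * value f (_/λ l l#0 a) fa
      lower = *-cong (_/λ l l#0 a) (_/λ l l#0 a)
        (value f (_/λ l l#0 a) (proj₁ h)) (value f (_/λ l l#0 a) fa)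
        ≃-refl (value-≃ ext ≃-refl (proj₁ h) fa)

      chain : ∀ J C r → J ≃ z * value f z fz + - C → 1ℂ * inv z z#0 ≡ r →
              J * inv z z#0′ ≃ value f z fz + - (C * r)
      chain J C r J≃ refl = ≃-trans
        (*-cong J (z * value f z fz + - C) (inv z z#0′) (inv z z#0) J≃ (inv-irrelevant z z#0′ z#0))
        (Inverse.cancel-difference z z#0 (value f z fz) C)

      unfolded : ∀ w → value (integralFrom l l#0 f a) (l * z) h * inv z z#0′ ≡ w → ∀ r → 1ℂ * inv z z#0 ≡ r →
        w ≃ value f z fz + - (_/λ l l#0 a * value f (_/λ l l#0 a) fa * r)
      unfolded w refl r r≡ = chain (value (integralFrom l l#0 f a) (l * z) h) (_/λ l l#0 a * value f (_/λ l l#0 a) fa) r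
        (∫-≃ f a (l * z) (_/λ l l#0 a * value f (_/λ l l#0 a) fa) (z * value f z fz) h upper lower) r≡

    𝐃-∫ : ∀ a z (z#0 : z # 0ℂ) (fz : Dom f z) (fa : Dom f (_/λ l l#0 a)) →
      𝐃 l l#0 (integralFrom l l#0 f a) [ z ]=
        (value f z fz - _/λ l l#0 a * value f (_/λ l l#0 a) fa * (1ℂ / z [ z#0 ]))
    𝐃-∫ a z z#0 fz fa = derive (value f z fz - _/λ l l#0 a * value f (_/λ l l#0 a) fa * (1ℂ / z [ z#0 ])) refl
      where
      derive : ∀ v → value f z fz + - (_/λ l l#0 a * value f (_/λ l l#0 a) fa * (1ℂ / z [ z#0 ])) ≡ v →
               𝐃 l l#0 (integralFrom l l#0 f a) [ z ]= v
      derive v refl = (v , (λ z#0′ → (z#0′ , integrable) , λ (z#0″ , h) → ≈-of (quotient-∫ a z z#0 z#0″ fz fa h)) ,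
                           (λ z≈0 → contradiction z#0 (≃⇒¬# {z} {0ℂ} ⟪ z≈0 ⟫))) ,
        -- Any other derivative `v′` is, by its implication for points apart from 0, a value of the
        -- same quotient.
        λ (v′ , deriv , _) → ≈-of (≃-trans
          (≃-sym (=-elim (quotient l l#0 (integralFrom l l#0 f a)) z v′ (deriv z#0) (z#0 , integrable)))
          (quotient-∫ a z z#0 z#0 fz fa integrable))
        where
        integrable : Integrable l l#0 f a (l * z)
        integrable = fa , Extensional.dom-resp ext (≈-of (≃-sym (l*-/λ z))) fz

    ∫₀-𝐃-# : ∀ z (fz : Dom f z) (p : Dom (𝐃 l l#0 f) (_/λ l l#0 z)) → _/λ l l#0 z # 0ℂ →
             ∫₀ l l#0 (𝐃 l l#0 f) z p ≃ value f z fz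
    ∫₀-𝐃-# z fz p z/λ#0 = at-quotient (proj₁ (proj₁ (proj₂ p) z/λ#0))
      where
      at-quotient : Dom (quotient l l#0 f) (_/λ l l#0 z) → ∫₀ l l#0 (𝐃 l l#0 f) z p ≃ value f z fz
      at-quotient (z/λ#0′ , q) = ≃-trans
        (*-cong (_/λ l l#0 z) (_/λ l l#0 z) (value (𝐃 l l#0 f) (_/λ l l#0 z) p)
          (value (quotient l l#0 f) (_/λ l l#0 z) (z/λ#0′ , q)) ≃-refl
          (≃-sym (=-elim (quotient l l#0 f) (_/λ l l#0 z) (proj₁ p) (proj₁ (proj₂ p) z/λ#0) (z/λ#0′ , q))))
        (≃-trans (*-quotient f (_/λ l l#0 z) z/λ#0′ q) (value-≃ ext (l*/λ z) q fz))

    ∫₀-𝐃-0 : ∀ z (p : Dom (𝐃 l l#0 f) (_/λ l l#0 z)) → _/λ l l#0 z ≃ 0ℂ →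
             ∫₀ l l#0 (𝐃 l l#0 f) z p ≃ 0ℂ
    ∫₀-𝐃-0 z p = *-≃0 (value (𝐃 l l#0 f) (_/λ l l#0 z) p)

    -- Whether x is 0 is undecided, so accumulation and continuity are supplied conditionally and
    -- called upon only in the branch where x / λ equals 0. There the integral is 0, and `AtZero`
    -- shows that f vanishes too.
    ∫₀-𝐃 : ∀ α β → DefinedOn f α β → ∀ x (fx : Dom f (fromℝ x)) →
           (x Real.≈ 0ℝ → Accumulates α β × ContinuousAt f α β 0ℝ) →
           (p : Dom (𝐃 l l#0 f) (_/λ l l#0 (fromℝ x))) →
           ∫₀ l l#0 (𝐃 l l#0 f) (fromℝ x) p ≃ value f (fromℝ x) fx
    ∫₀-𝐃 α β defined x fx at-0 p = #-cases {_/λ l l#0 (fromℝ x)} {0ℂ} (∫₀-𝐃-# (fromℝ x) fx p)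
      λ x/λ≃0 → ≃-trans (∫₀-𝐃-0 (fromℝ x) p x/λ≃0)
        (vanishing x/λ≃0 (≃-trans (≃-sym (l*/λ (fromℝ x)))
          (≃-trans (*-cong l l (_/λ l l#0 (fromℝ x)) 0ℂ ≃-refl x/λ≃0)
            (IsCommutativeRing.zeroʳ +-*-isCommutativeRing l))))
      where
      vanishing : _/λ l l#0 (fromℝ x) ≃ 0ℂ → fromℝ x ≃ 0ℂ → 0ℂ ≃ value f (fromℝ x) fx
      vanishing x/λ≃0 x≃0 = at-zero (Extensional.dom-resp ext (≈-of x≃0) fx) (at-0 (proj₁ (≈-of x≃0)))
        where
        at-zero : Dom f (fromℝ 0ℝ) → Accumulates α β × ContinuousAt f α β 0ℝ → 0ℂ ≃ value f (fromℝ x) fx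
        at-zero q (accumulates , continuous) = ≃-sym (≃-trans (value-≃ ext x≃0 fx q)
          (AtZero.value-zero f ext α β defined accumulates continuous (proj₁ p)
            (proj₂ (proj₂ p) (≈-of x/λ≃0)) q))

    -- Away from 0 both integrals are values of f at equal points. At 0 both vanish with their first
    -- factor, whichever limits `p` and `q` carry.
    ∫₀-𝐃-cong : ∀ z w (p : Dom (𝐃 l l#0 f) (_/λ l l#0 z)) (q : Dom (𝐃 l l#0 f) (_/λ l l#0 w)) →
      (fz : Dom f z) (fw : Dom f w) → z ≃ w →
      ∫₀ l l#0 (𝐃 l l#0 f) z p ≃ ∫₀ l l#0 (𝐃 l l#0 f) w q
    ∫₀-𝐃-cong z w p q fz fw z≃w = #-cases {_/λ l l#0 z} {0ℂ}
      (λ z/λ#0 → #-cases {_/λ l l#0 w} {0ℂ}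
        (λ w/λ#0 → ≃-trans (∫₀-𝐃-# z fz p z/λ#0)
          (≃-trans (value-≃ ext z≃w fz fw) (≃-sym (∫₀-𝐃-# w fw q w/λ#0))))
        (λ w/λ≃0 → contradiction z/λ#0 (≃⇒¬# {_/λ l l#0 z} {0ℂ} (≃-trans (/λ-cong z w z≃w) w/λ≃0))))
      (λ z/λ≃0 → ≃-trans (∫₀-𝐃-0 z p z/λ≃0)
        (≃-sym (∫₀-𝐃-0 w q (≃-trans (/λ-cong w z (≃-sym z≃w)) z/λ≃0))))

    ∫-𝐃 : ∀ α β → α Real.≤ β → DefinedOn f α β → ContinuousAtZeroEndpoint f α β →
      𝓛¹ l l#0 α β (𝐃 l l#0 f) → (fα : Dom f (fromℝ α)) (fβ : Dom f (fromℝ β)) →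
      integralFrom l l#0 (𝐃 l l#0 f) (fromℝ α) [ fromℝ β ]=
        (value f (fromℝ β) fβ - value f (fromℝ α) fα)
    ∫-𝐃 α β α≤β defined continuous (_ , integrable) fα fβ = integrable , λ h →
      ≈-of (unfolded h (value (integralFrom l l#0 (𝐃 l l#0 f) (fromℝ α)) (fromℝ β) h) refl
                       (value f (fromℝ β) fβ - value f (fromℝ α) fα) refl)
      where
      proper : ∀ h → α Real.< β → ∫ l l#0 (𝐃 l l#0 f) (fromℝ α) (fromℝ β) h ≃
                                  value f (fromℝ β) fβ + - value f (fromℝ α) fα
      proper h α<β = ∫-≃ (𝐃 l l#0 f) (fromℝ α) (fromℝ β) (value f (fromℝ α) fα) (value f (fromℝ β) fβ) h
        (∫₀-𝐃 α β defined β fβ (λ β≈0 → Endpoints.accumulates-right α β α<β β≈0 , continuous (inj₂ β≈0)) (proj₂ h))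
        (∫₀-𝐃 α β defined α fα (λ α≈0 → Endpoints.accumulates-left α β α<β α≈0 , continuous (inj₁ α≈0)) (proj₁ h))

      degenerate : ∀ h → α Real.≈ β → ∫ l l#0 (𝐃 l l#0 f) (fromℝ α) (fromℝ β) h ≃
                                      value f (fromℝ β) fβ + - value f (fromℝ α) fα
      degenerate h α≈β = ≃-trans
        (∫-≃ (𝐃 l l#0 f) (fromℝ α) (fromℝ β)
          (∫₀ l l#0 (𝐃 l l#0 f) (fromℝ α) (proj₁ h)) (∫₀ l l#0 (𝐃 l l#0 f) (fromℝ β) (proj₂ h)) h ≃-refl ≃-refl)
        (≃-trans (minus-≃0 (∫₀ l l#0 (𝐃 l l#0 f) (fromℝ β) (proj₂ h)) (∫₀ l l#0 (𝐃 l l#0 f) (fromℝ α) (proj₁ h))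
            (≃-sym (∫₀-𝐃-cong (fromℝ α) (fromℝ β) (proj₁ h) (proj₂ h) fα fβ α≃β)))
          (≃-sym (minus-≃0 (value f (fromℝ β) fβ) (value f (fromℝ α) fα)
            (≃-sym (value-≃ ext α≃β fα fβ)))))
        where
        α≃β : fromℝ α ≃ fromℝ β
        α≃β = fromℝ-cong α β α≈β

      unfolded : ∀ h w → ∫ l l#0 (𝐃 l l#0 f) (fromℝ α) (fromℝ β) h ≡ w →
                 ∀ v → value f (fromℝ β) fβ + - value f (fromℝ α) fα ≡ v → w ≃ v
      unfolded h w refl v refl = ≤-cases α β α≤β (proper h) (degenerate h)

theorem1 : (lam : ℂ) (lam#0 : lam Complex.# Complex.0ℂ) (α β : ℝ) → α Real.≤ β →
  let open Complex
      open LambdaCalculus lam lam#0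
  in
    (∀ (f : PartialMap) → Extensional f → DefinedOn f α β →
      (∀ x → x ∈[ α , β ] → 𝓛¹ α x f) →
      ∀ x → x ∈[ α , β ] → (x#0 : fromℝ x # 0ℂ) →
      (fx : Dom f (fromℝ x)) (fα/λ : Dom f (fromℝ α /λ)) →
      𝐃 (integralFrom f (fromℝ α)) [ fromℝ x ]=
        (value f (fromℝ x) fx
          - (fromℝ α /λ) * value f (fromℝ α /λ) fα/λ * (1ℂ / fromℝ x [ x#0 ])))
    ×
    (∀ (f : PartialMap) → Extensional f → DefinedOn f α β →
      ContinuousAtZeroEndpoint f α β →
      𝓛¹ α β (𝐃 f) →
      (fα : Dom f (fromℝ α)) (fβ : Dom f (fromℝ β)) →
      integralFrom (𝐃 f) (fromℝ α) [ fromℝ β ]=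
        (value f (fromℝ β) fβ - value f (fromℝ α) fα))
theorem1 lam lam#0 α β α≤β =
  (λ f ext _ _ x _ x#0 fx fα/λ → 𝐃-∫ f ext (fromℝ α) (fromℝ x) x#0 fx fα/λ) ,
  (λ f ext defined continuous integrable fα fβ → ∫-𝐃 f ext α β α≤β defined continuous integrable fα fβ)
  where open LambdaCalculusProperties lam lam#0
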